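{- There is an absolute constant $c>0$ such that the following holds. Let $r\ge 2$ and $d\ge 16$ be integers and let $G$ be a graph on $n$ vertices with maximum degree at most $d$ that contains no clique $K_r$ (as a subgraph). Then $$\alpha(G)\;\ge\; c\,\frac{n}{d}\cdot\max\left(\frac{\log d}{r\log\log d},\ \left(\frac{\log d}{\log r}\right)^{1/2}\right).$$ In particular, if $r=\log^{c'} d$ with $c'\ge 1$, then $\alpha(G)=\Omega\big(\frac{n}{d}\big(\frac{\log d}{c'\log\log d}\big)^{1/2}\big)$.
   Context: $\alpha(G)$ is the maximum size of an independent set in $G$. $K_r$ denotes the complete graph on $r$ vertices; $G$ is $K_r$-free if it has no $r$ pairwise adjacent vertices. Logarithms are base 2. -}

module Defs where

open import Data.Fin.Base using (Fin)
open import Data.Fin.Properties using (all?)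
open import Data.Fin.Subset using (Subset; inside; outside; _∈_; ∣_∣)
open import Data.Fin.Subset.Properties using (_∈?_)
open import Data.Integer.Base using (ℤ; +_; -[1+_])
open import Data.List.Base using (List; []; _∷_; map; filter; cartesianProductWith)
open import Data.List.Extrema.Nat using (max)
open import Data.Nat.Base as ℕ using (ℕ; zero; suc)
open import Data.Product.Base using (∃; _×_)
open import Data.Rational.Base as ℚ using (ℚ; 0ℚ; 1ℚ; ½; ↥_; ↧ₙ_; _<_; _≤_; _*_)
open import Data.Sum.Base using (_⊎_)
open import Data.Vec.Base using ([]; _∷_; tabulate)
open import Level using (0ℓ)
open import Relation.Binary.Core using (Rel)
open import Relation.Binary.Definitions using (Symmetric; Irreflexive; Decidable)
open import Relation.Binary.PropositionalEquality.Core using (_≡_; _≢_)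
open import Relation.Nullary.Decidable using (Dec; does; ¬?; _→-dec_)
open import Relation.Nullary.Negation using (¬_)
import Algebra.Definitions.RawSemiring ℚ.+-*-rawSemiring as Exp

------------------------------------------------------------------------
-- Finite simple graphs

record Graph (n : ℕ) : Set₁ where
  field
    _~_    : Rel (Fin n) 0ℓ
    sym    : Symmetric _~_
    irrefl : Irreflexive _≡_ _~_
    _~?_   : Decidable _~_

  neighbours : Fin n → Subset n
  neighbours v = tabulate (λ u → does (v ~? u))

  degree : Fin n → ℕ
  degree v = ∣ neighbours v ∣

  Independent : Subset n → Set
  Independent S = ∀ u v → u ∈ S → v ∈ S → ¬ (u ~ v)

  independent? : ∀ S → Dec (Independent S)
  independent? S = all? λ u → all? λ v →
    (u ∈? S) →-dec ((v ∈? S) →-dec ¬? (u ~? v))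

  Clique : Subset n → Set
  Clique S = ∀ u v → u ∈ S → v ∈ S → u ≢ v → u ~ v

MaxDegreeAtMost : ∀ {n} → ℕ → Graph n → Set
MaxDegreeAtMost d G = ∀ v → Graph.degree G v ℕ.≤ d

CliqueFree : ∀ {n} → ℕ → Graph n → Set
CliqueFree r G = ∀ S → ∣ S ∣ ≡ r → ¬ Graph.Clique G S

subsets : ∀ n → List (Subset n)
subsets zero    = [] ∷ []
subsets (suc n) = cartesianProductWith _∷_ (inside ∷ outside ∷ []) (subsets n)

-- The base value 0 of the maximum is the size of the empty independent set.
α : ∀ {n} → Graph n → ℕ
α {n} G = max 0 (map ∣_∣ (filter (Graph.independent? G) (subsets n)))

------------------------------------------------------------------------
-- Real numbers as two-sided Dedekind cuts: L holds of the rationals below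
-- the number and U of those above it.  The operations are given by formulas
-- on arbitrary pairs (L , U), so that partial ones need no proof argument;
-- each is the usual operation on reals in the domain stated next to it.

record Cut : Set₁ where
  field
    L U : ℚ → Set

open Cut public

record IsReal (x : Cut) : Set where
  field
    L-inhabited : ∃ λ q → L x q
    U-inhabited : ∃ λ q → U x q
    L-closed    : ∀ {p q} → p < q → L x q → L x p
    U-closed    : ∀ {p q} → p < q → U x p → U x q
    L-open      : ∀ {p} → L x p → ∃ λ q → p < q × L x q
    U-open      : ∀ {q} → U x q → ∃ λ p → p < q × U x p
    disjoint    : ∀ {q} → L x q → ¬ U x q
    located     : ∀ {p q} → p < q → L x p ⊎ U x q

infix 4 _≤ᵣ_ _<ᵣ_ _≈ᵣ_

_≤ᵣ_ : Cut → Cut → Set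
x ≤ᵣ y = ∀ q → L x q → L y q

_<ᵣ_ : Cut → Cut → Set
x <ᵣ y = ∃ λ q → U x q × L y q

_≈ᵣ_ : Cut → Cut → Set
x ≈ᵣ y = x ≤ᵣ y × y ≤ᵣ x

fromℚ : ℚ → Cut
fromℚ q .L p = p < q
fromℚ q .U p = q < p

fromℕ : ℕ → Cut
fromℕ n = fromℚ (+ n ℚ./ 1)

0ᵣ 1ᵣ : Cut
0ᵣ = fromℕ 0
1ᵣ = fromℕ 1

infixl 6 _⊔ᵣ_
infixl 7 _*ᵣ_ _/ᵣ_
infixr 8 _^ᵣ_
infix  9 _⁻¹ᵣ

_⊔ᵣ_ : Cut → Cut → Cut
(x ⊔ᵣ y) .L q = L x q ⊎ L y q
(x ⊔ᵣ y) .U q = U x q × U y q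

-- Interval multiplication: q is compared with the four corners of a rational
-- box around (x , y), so no case distinction on signs is needed.
_*ᵣ_ : Cut → Cut → Cut
(x *ᵣ y) .L q = ∃ λ a → ∃ λ b → ∃ λ c → ∃ λ e →
  (L x a × U x b × L y c × U y e) ×
  (q < a * c × q < a * e × q < b * c × q < b * e)
(x *ᵣ y) .U q = ∃ λ a → ∃ λ b → ∃ λ c → ∃ λ e →
  (L x a × U x b × L y c × U y e) ×
  (a * c < q × a * e < q × b * c < q × b * e < q)

-- For x > 0: q < 1/x iff q · t < 1 for some t > x (also when q ≤ 0), and
-- 1/x < q iff 1 < q · t for some t with 0 < t < x.
_⁻¹ᵣ : Cut → Cut
(x ⁻¹ᵣ) .L q = ∃ λ t → U x t × q * t < 1ℚ
(x ⁻¹ᵣ) .U q = ∃ λ t → L x t × 0ℚ < t × 1ℚ < q * t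

_/ᵣ_ : Cut → Cut → Cut
x /ᵣ y = x *ᵣ y ⁻¹ᵣ

-- For x ≥ 0.
√ : Cut → Cut
√ x .L q = q < 0ℚ ⊎ L x (q * q)
√ x .U q = 0ℚ < q × U x (q * q)

2^ : ℤ → ℚ
2^ (+ n)    = (1ℚ ℚ.+ 1ℚ) Exp.^ n
2^ -[1+ n ] = ½ Exp.^ suc n

-- Comparison of a rational t with 2^s for rational s = a / b, through the
-- equivalence, for t > 0, of t < 2^(a/b) with t^b < 2^a.
infix 4 _<2^_ _>2^_

_<2^_ : ℚ → ℚ → Set
t <2^ s = t ≤ 0ℚ ⊎ t Exp.^ (↧ₙ s) < 2^ (↥ s)

_>2^_ : ℚ → ℚ → Set
t >2^ s = 0ℚ < t × 2^ (↥ s) < t Exp.^ (↧ₙ s)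

-- Base 2, for x > 0: q < log x iff 2^q < t for some rational t < x.
log : Cut → Cut
log x .L q = ∃ λ t → L x t × t >2^ q
log x .U q = ∃ λ t → U x t × t <2^ q

-- The function 2^y: q < 2^y iff q < 2^s for some rational s < y.
exp₂ : Cut → Cut
exp₂ y .L q = ∃ λ s → L y s × q <2^ s
exp₂ y .U q = ∃ λ s → U y s × q >2^ s

-- For x > 0.
_^ᵣ_ : Cut → Cut → Cut
x ^ᵣ y = exp₂ (y *ᵣ log x)

{-# OPTIONS --safe #-}

-- Let W be a uniformly random independent set and X_v = d [v ∈ W] + |N(v) ∩ W|.  Then Σ_v X_v ≤ 2d |W|,
-- so it suffices to bound every E X_v from below.  Fix the part of W outside the closed neighbourhood
-- of v.  The rest of W is either {v} or an independent set of the graph induced on a set p of neighbours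
-- of v; let I be the number of these sets.  If I is at most about √d, then v ∈ W is likely enough.
-- Otherwise at most (1 + |p|)^s of them have fewer than s elements, hence their mean size is at least of
-- order log I / log |p|.  It remains to bound |p| from above in terms of I.  The Ramsey bound
-- 1 + |p| < (2 + log I)^r gives the first term of the maximum.  For the second, a K_r-free graph has
-- a vertex with at least |p| / r non-neighbours, and iterating over the choices of such vertices gives
-- log I ≥ const · (log |p|)² / log r.

module Submission where

open import Defs
open import Algebra.Definitions.RawSemiring as RawSemiring using ()
open import Data.Bool.Base using (Bool; true; false; _∧_; _∨_; not; if_then_else_)
open import Data.Bool.Properties using (∧-zeroʳ; ∧-identityʳ)
open import Data.Fin.Base using (Fin; zero; suc)
open import Data.Fin.Properties using (_≟_)
open import Data.Fin.Subset using (Subset; inside; outside; ∣_∣) renaming (_∈_ to _∈ˢ_)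
open import Data.Integer.Base as ℤ using (-[1+_])
import Data.Integer.Properties as ℤ
open import Data.List.Base using (List; []; _∷_; map; allFin; length; tabulate)
open import Data.List.Extrema.Nat using (v≤max⁺)
open import Data.List.Membership.Propositional using (_∈_)
open import Data.List.Membership.Propositional.Properties
  using (∈-allFin; ∈-filter⁺; ∈-map⁺; ∈-cartesianProductWith⁺)
open import Data.List.Properties using (length-tabulate)
open import Data.List.Relation.Unary.All as All using (All)
open import Data.List.Relation.Unary.AllPairs using ([]; _∷_)
open import Data.List.Relation.Unary.Any as Any using (here; there)
open import Data.List.Relation.Unary.Unique.Propositional using (Unique)
open import Data.List.Relation.Unary.Unique.Propositional.Properties using (allFin⁺)
open import Data.Nat.Base hiding (_/_; _%_)
open import Data.Nat.Coprimality using (Coprime; 1-coprimeTo) renaming (sym to coprime-sym)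
open import Data.Nat.DivMod using (_/_; _%_; m/n*n≤m; m%n<n; m≡m%n+[m/n]*n)
open import Data.Nat.ListAction using (sum)
open import Data.Nat.Properties hiding (_≟_)
open import Data.Nat.Tactic.RingSolver using (solve-∀)
open import Data.Product.Base using (Σ-syntax; ∃; ∃₂; _×_; _,_; proj₁; proj₂)
open import Data.Rational.Base as ℚ using (ℚ; 0ℚ; 1ℚ; ½; mkℚ)
import Data.Rational.Properties as ℚ
open import Data.Rational.Solver using (module +-*-Solver)
import Data.Rational.Unnormalised.Base as ℚᵘ
open import Data.Sum.Base using (_⊎_; inj₁; inj₂)
open import Data.Vec.Base as Vec using ()
open import Data.Vec.Properties using (lookup∘tabulate; []=⇒lookup)
open import Function.Base using (_∘_; id; case_of_)
open import Relation.Binary.PropositionalEquality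
open import Relation.Nullary using (¬_; Dec; does; yes; no; contradiction)
open import Relation.Nullary.Decidable using (dec-true; dec-false)

-- Weighted sums over independent sets

-- Expectations are kept as integers: multiplied by the number of independent sets, each becomes a
-- sum over these sets, so the graph theory takes place in ℕ. There log d, log log d and log r are
-- represented by their integer parts, and the real inequality is tested on every rational x / y
-- below the last factor. The term d [v ∈ W] serves the neighbourhoods that leave few choices: {v}
-- is then one of 1 + I sets, and the weight d on it gives an average of about √d, which beats every
-- target because the targets have at most the order of log d. The same weight matches the degree
-- bound, so each element of W is counted at most 2d times. The constant 1/512 is 1/(32 · 16). The
-- averaging costs 8 = 4 · 2, rounding the target to an integer doubles this to 16, and 32 is the
-- slack consumed by the comparison of exponents.

Pred : ℕ → Set
Pred n = Fin n → Bool

infix 4 _⊆_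
infixl 7 _∩_ _∖_
infixl 6 _∪_

_⊆_ : ∀ {n} → Pred n → Pred n → Set
p ⊆ q = ∀ {u} → p u ≡ true → q u ≡ true

⁅_⁆ : ∀ {n} → Fin n → Pred n
⁅ v ⁆ u = does (u ≟ v)

∅ : ∀ {n} → Pred n
∅ _ = false

_∩_ _∪_ _∖_ : ∀ {n} → Pred n → Pred n → Pred n
(p ∩ q) u = p u ∧ q u
(p ∪ q) u = p u ∨ q u
(p ∖ q) u = p u ∧ not (q u)

∧-true : ∀ {a b} → a ∧ b ≡ true → a ≡ true × b ≡ true
∧-true {true} {true} _ = refl , refl

∧-intro : ∀ {a b} → a ≡ true → b ≡ true → a ∧ b ≡ true
∧-intro refl refl = refl

∨-true : ∀ {a b} → a ∨ b ≡ true → a ≡ true ⊎ b ≡ true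
∨-true {true} _ = inj₁ refl
∨-true {false} eq = inj₂ eq

not-true : ∀ {a} → not a ≡ true → a ≡ false
not-true {false} _ = refl

does-true : ∀ {A : Set} (a? : Dec A) → does a? ≡ true → A
does-true (yes a) _ = a

does-false : ∀ {A : Set} (a? : Dec A) → does a? ≡ false → ¬ A
does-false (no ¬a) _ = ¬a

⁅⁆-self : ∀ {n} (v : Fin n) → ⁅ v ⁆ v ≡ true
⁅⁆-self v = dec-true (v ≟ v) refl

⁅⁆-other : ∀ {n} {u v : Fin n} → u ≢ v → ⁅ v ⁆ u ≡ false
⁅⁆-other {u = u} {v} = dec-false (u ≟ v)

⁅⁆-true : ∀ {n} {u v : Fin n} → ⁅ v ⁆ u ≡ true → u ≡ v
⁅⁆-true {u = u} {v} = does-true (u ≟ v)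

⁅⁆-sym : ∀ {n} (u v : Fin n) → ⁅ u ⁆ v ≡ ⁅ v ⁆ u
⁅⁆-sym u v with u ≟ v
... | yes refl = dec-true (v ≟ u) refl
... | no u≢v = dec-false (v ≟ u) (≢-sym u≢v)

true≢false : ∀ {b} → b ≡ true → b ≢ false
true≢false refl ()

gate : Bool → ℕ → ℕ
gate b k = if b then k else 0

gate-mono : ∀ {b b′ k k′} → (b ≡ true → b′ ≡ true) → k ≤ k′ → gate b k ≤ gate b′ k′
gate-mono {false} _ _ = z≤n
gate-mono {true} {true} _ k≤k′ = k≤k′
gate-mono {true} {false} f _ = case f refl of λ ()

card : ∀ {n} → Pred n → List (Fin n) → ℕ
card p [] = 0
card p (v ∷ xs) = gate (p v) 1 + card p xs

card-∅ : ∀ {n} (xs : List (Fin n)) → card ∅ xs ≡ 0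
card-∅ [] = refl
card-∅ (_ ∷ xs) = card-∅ xs

card-cong : ∀ {n} {p q : Pred n} xs → (∀ {u} → u ∈ xs → p u ≡ q u) → card p xs ≡ card q xs
card-cong [] _ = refl
card-cong (v ∷ xs) eq = cong₂ (λ b k → gate b 1 + k) (eq (here refl)) (card-cong xs (eq ∘ there))

card-mono : ∀ {n} {p q : Pred n} xs → p ⊆ q → card p xs ≤ card q xs
card-mono [] _ = z≤n
card-mono {p = p} (v ∷ xs) p⊆q = +-mono-≤ (gate-mono {p v} p⊆q ≤-refl) (card-mono xs p⊆q)

card-cover : ∀ {n} {p q q′ : Pred n} xs →
  (∀ {u} → p u ≡ true → q u ≡ true ⊎ q′ u ≡ true) → card p xs ≤ card q xs + card q′ xs
card-cover [] _ = z≤n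
card-cover {p = p} {q} {q′} (v ∷ xs) cover = begin
  gate (p v) 1 + card p xs                                      ≤⟨ +-mono-≤ (head (p v) refl) (card-cover xs cover) ⟩
  (gate (q v) 1 + gate (q′ v) 1) + (card q xs + card q′ xs)     ≡⟨ +-interchange (gate (q v) 1) _ _ _ ⟩
  (gate (q v) 1 + card q xs) + (gate (q′ v) 1 + card q′ xs)     ∎
  where
  open ≤-Reasoning
  +-interchange : ∀ a b c e → (a + b) + (c + e) ≡ (a + c) + (b + e)
  +-interchange = solve-∀
  head : ∀ b → p v ≡ b → gate b 1 ≤ gate (q v) 1 + gate (q′ v) 1
  head false _ = z≤n
  head true pv with cover pv
  ... | inj₁ qv rewrite qv = s≤s z≤n
  ... | inj₂ qv rewrite qv = m≤n+m 1 (gate (q v) 1)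

fresh : ∀ {n} {v : Fin n} {xs u} → All (v ≢_) xs → u ∈ xs → u ≢ v
fresh v∉ u∈ refl = All.lookup v∉ u∈ refl

card-insert : ∀ {n} {p : Pred n} {v xs} → Unique xs → v ∈ xs → p v ≡ false →
  card (⁅ v ⁆ ∪ p) xs ≡ suc (card p xs)
card-insert {p = p} {v} {_ ∷ xs} (v∉ ∷ _) (here refl) pv
  rewrite ⁅⁆-self v | pv = cong suc (card-cong xs λ u∈ → cong (_∨ p _) (⁅⁆-other (fresh v∉ u∈)))
card-insert {p = p} {v} {u ∷ xs} (u∉ ∷ uniq) (there v∈) pv
  rewrite ⁅⁆-other (≢-sym (fresh u∉ v∈)) =
    trans (cong (gate (p u) 1 +_) (card-insert {p = p} uniq v∈ pv)) (+-suc _ _)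

card-singleton : ∀ {n} {v : Fin n} {xs} → Unique xs → v ∈ xs → card ⁅ v ⁆ xs ≡ 1
card-singleton {v = v} {xs} uniq v∈ = begin
  card ⁅ v ⁆ xs         ≡⟨ card-cong xs (λ _ → sym (∨-false _)) ⟩
  card (⁅ v ⁆ ∪ ∅) xs   ≡⟨ card-insert uniq v∈ refl ⟩
  suc (card ∅ xs)       ≡⟨ cong suc (card-∅ xs) ⟩
  1                     ∎
  where
  open ≡-Reasoning
  ∨-false : ∀ b → b ∨ false ≡ b
  ∨-false false = refl
  ∨-false true = refl

card-nonempty : ∀ {n} {p : Pred n} xs → 0 < card p xs → ∃ λ v → p v ≡ true
card-nonempty {p = p} (v ∷ xs) 0< with p v in pv
... | true = v , pv
... | false = card-nonempty xs 0<

card-tabulate : ∀ {n} (p : Pred n) {m} (f : Fin m → Fin n) →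
  card p (tabulate f) ≡ ∣ Vec.tabulate (p ∘ f) ∣
card-tabulate p {zero} f = refl
card-tabulate p {suc m} f with p (f zero)
... | true = cong suc (card-tabulate p (f ∘ suc))
... | false = card-tabulate p (f ∘ suc)

⟦_⟧ : ∀ {n} → Pred n → Subset n
⟦ p ⟧ = Vec.tabulate p

∈⟦⟧ : ∀ {n} {p : Pred n} {u} → u ∈ˢ ⟦ p ⟧ → p u ≡ true
∈⟦⟧ {p = p} {u} u∈ = trans (sym (lookup∘tabulate p u)) ([]=⇒lookup u∈)

∈-subsets : ∀ {n} (S : Subset n) → S ∈ subsets n
∈-subsets Vec.[] = here refl
∈-subsets {suc n} (b Vec.∷ S) =
  ∈-cartesianProductWith⁺ Vec._∷_ {xs = inside ∷ outside ∷ []} {subsets n} {b} {S} (sides b) (∈-subsets S)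
  where
  sides : ∀ b → b ∈ inside ∷ outside ∷ []
  sides true = here refl
  sides false = there (here refl)

module Counting {n : ℕ} (G : Graph n) where
  open Graph G using (_~_; irrefl; _~?_) renaming (sym to ~-sym)

  V : List (Fin n)
  V = allFin n

  adj : Fin n → Pred n
  adj v u = does (v ~? u)

  sep : Fin n → Pred n
  sep v u = not (⁅ v ⁆ u) ∧ not (adj v u)

  infixl 7 _#_ _-_

  _#_ _-_ : Pred n → Fin n → Pred n
  p # v = p ∩ sep v
  p - v = p ∖ ⁅ v ⁆

  adj-sym : ∀ u v → adj u v ≡ adj v u
  adj-sym u v with v ~? u
  ... | yes v~u = dec-true (u ~? v) (~-sym v~u)
  ... | no v≁u = dec-false (u ~? v) (v≁u ∘ ~-sym)

  adj-irrefl : ∀ v → adj v v ≡ false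
  adj-irrefl v = dec-false (v ~? v) (irrefl refl)

  sep-sym : ∀ u v → sep u v ≡ sep v u
  sep-sym u v = cong₂ (λ a b → not a ∧ not b) (⁅⁆-sym u v) (adj-sym u v)

  sep-self : ∀ v → sep v v ≡ false
  sep-self v rewrite ⁅⁆-self v = refl

  -- Each independent set W ⊆ p is generated by adding its elements in the order of the list, so
  -- weigh w a p xs is the sum of a + Σ_{u ∈ W} w u over these W.
  weigh : (Fin n → ℕ) → ℕ → Pred n → List (Fin n) → ℕ
  weigh w a p [] = a
  weigh w a p (v ∷ xs) = weigh w a p xs + gate (p v) (weigh w (a + w v) (p # v) xs)

  weigh-cong : ∀ {w a a′ p q} xs → a ≡ a′ → (∀ {u} → u ∈ xs → p u ≡ q u) →
    weigh w a p xs ≡ weigh w a′ q xs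
  weigh-cong [] a≡ _ = a≡
  weigh-cong {w} {p = p} {q} (v ∷ xs) refl eq = cong₂ _+_
    (weigh-cong xs refl (eq ∘ there))
    (cong₂ gate (eq (here refl))
      (weigh-cong xs refl λ u∈ → cong (_∧ sep v _) (eq (there u∈))))

  weigh-mono : ∀ {w w′ a a′ p q} xs → (∀ u → p u ≡ true → w u ≤ w′ u) → a ≤ a′ → p ⊆ q →
    weigh w a p xs ≤ weigh w′ a′ q xs
  weigh-mono [] _ a≤ _ = a≤
  weigh-mono {w} {w′} {a} {a′} {p} {q} (v ∷ xs) w≤ a≤ p⊆q =
    +-mono-≤ (weigh-mono xs w≤ a≤ p⊆q) (branch (p v) refl)
    where
    branch : ∀ b → p v ≡ b →
      gate b (weigh w (a + w v) (p # v) xs) ≤ gate (q v) (weigh w′ (a′ + w′ v) (q # v) xs)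
    branch false _ = z≤n
    branch true pv = gate-mono {true} (λ _ → p⊆q pv) (weigh-mono xs
      (λ u pu → w≤ u (proj₁ (∧-true pu))) (+-mono-≤ a≤ (w≤ v pv))
      (λ pu → ∧-intro (p⊆q (proj₁ (∧-true pu))) (proj₂ (∧-true {p _} pu))))

  weigh-∅ : ∀ {w a p} xs → (∀ {u} → u ∈ xs → p u ≡ false) → weigh w a p xs ≡ a
  weigh-∅ [] _ = refl
  weigh-∅ {w} {a} {p} (v ∷ xs) empty rewrite empty (here refl) =
    trans (+-identityʳ _) (weigh-∅ xs (empty ∘ there))

  -- The recursion branches only at the head of the list; this makes every vertex of p available for
  -- branching. Two non-adjacent vertices can be decided in either order. If v is adjacent to the
  -- head u, choosing u already excludes v, so only the branch without u is split.
  weigh-split-∷ : ∀ {w a p v} {xs} → Unique xs → v ∈ xs → p v ≡ true →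
    weigh w a p xs ≡ weigh w a (p - v) xs + weigh w (a + w v) (p # v) xs
  weigh-split-∷ {w} {a} {p} {v} {_ ∷ xs} (v∉ ∷ _) (here refl) pv
    rewrite pv | ⁅⁆-self v | +-identityʳ (weigh w a (p - v) xs)
          | +-identityʳ (weigh w (a + w v) (p # v) xs)
    = cong (_+ weigh w (a + w v) (p # v) xs) (weigh-cong xs refl λ {u} u∈ →
        sym (trans (cong (λ b → p u ∧ not b) (⁅⁆-other (fresh v∉ u∈))) (∧-identityʳ (p u))))
  weigh-split-∷ {w} {a} {p} {v} {u ∷ xs} (u∉ ∷ uniq) (there v∈) pv with p u in pu
  ... | false = begin
    weigh w a p xs + 0                                                      ≡⟨ +-identityʳ _ ⟩
    weigh w a p xs                                                          ≡⟨ weigh-split-∷ uniq v∈ pv ⟩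
    weigh w a (p - v) xs + weigh w (a + w v) (p # v) xs
      ≡⟨ cong₂ _+_ (+-identityʳ (weigh w a (p - v) xs))
           (+-identityʳ (weigh w (a + w v) (p # v) xs)) ⟨
    weigh w a (p - v) xs + 0 + (weigh w (a + w v) (p # v) xs + 0)           ∎
    where open ≡-Reasoning
  ... | true rewrite ⁅⁆-other (≢-sym (fresh u∉ v∈)) = begin
    weigh w a p xs + weigh w (a + w u) (p # u) xs
      ≡⟨ cong (_+ weigh w (a + w u) (p # u) xs) (weigh-split-∷ uniq v∈ pv) ⟩
    (A + B) + weigh w (a + w u) (p # u) xs
      ≡⟨ cong ((A + B) +_) (rest (adj v u) refl) ⟩
    (A + B) + (C + gate (not (adj v u)) D)
      ≡⟨ swap A B C _ ⟩
    (A + C) + (B + gate (not (adj v u)) D) ∎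
    where
    open ≡-Reasoning
    A = weigh w a (p - v) xs
    B = weigh w (a + w v) (p # v) xs
    C = weigh w (a + w u) ((p - v) # u) xs
    D = weigh w (a + w v + w u) ((p # v) # u) xs
    swap : ∀ x y z t → (x + y) + (z + t) ≡ (x + z) + (y + t)
    swap = solve-∀
    comm : ∀ (x y z : Bool) → (x ∧ y) ∧ z ≡ (x ∧ z) ∧ y
    comm true true true = refl
    comm true true false = refl
    comm true false true = refl
    comm true false false = refl
    comm false _ _ = refl
    sep-vu : ∀ b → adj v u ≡ b → sep u v ≡ not b
    sep-vu b eq = trans (sep-sym u v)
      (cong₂ (λ x y → not x ∧ not y) (⁅⁆-other (≢-sym (fresh u∉ v∈))) eq)
    rest : ∀ b → adj v u ≡ b →
      weigh w (a + w u) (p # u) xs ≡ C + gate (not b) D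
    rest true v~u = trans (weigh-cong xs refl same) (sym (+-identityʳ C))
      where
      same : ∀ {y} → y ∈ xs → (p # u) y ≡ ((p - v) # u) y
      same {y} _ with y ≟ v
      ... | yes refl rewrite sep-vu true v~u | ∧-zeroʳ (p y) = refl
      ... | no _ rewrite ∧-identityʳ (p y) = refl
    rest false v≁u = trans
      (weigh-split-∷ uniq v∈ (∧-intro pv (sep-vu false v≁u)))
      (cong₂ _+_ (weigh-cong xs refl λ {y} _ → comm (p y) _ _)
        (weigh-cong xs (comm-+ a (w u) (w v)) λ {y} _ → comm (p y) _ _))
      where
      comm-+ : ∀ x y z → x + y + z ≡ x + z + y
      comm-+ = solve-∀

  ∣_∣ᵖ : Pred n → ℕ
  ∣ p ∣ᵖ = card p V

  W : (Fin n → ℕ) → ℕ → Pred n → ℕ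
  W w a p = weigh w a p V

  I : Pred n → ℕ
  I = W (λ _ → 0) 1

  W-split : ∀ {w a p v} → p v ≡ true → W w a p ≡ W w a (p - v) + W w (a + w v) (p # v)
  W-split = weigh-split-∷ (allFin⁺ n) (∈-allFin _)

  I-mono : ∀ {p q} → p ⊆ q → I p ≤ I q
  I-mono = weigh-mono V (λ _ _ → z≤n) ≤-refl

  weigh-lower : ∀ w a p xs → a ≤ weigh w a p xs
  weigh-lower w a p [] = ≤-refl
  weigh-lower w a p (v ∷ xs) = ≤-trans (weigh-lower w a p xs) (m≤m+n _ _)

  I-positive : ∀ p → 1 ≤ I p
  I-positive p = weigh-lower _ 1 p V

  #⊆ : ∀ p v → (p # v) ⊆ p
  #⊆ p v pu = proj₁ (∧-true pu)

  -⊆ : ∀ p v → (p - v) ⊆ p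
  -⊆ p v pu = proj₁ (∧-true pu)

  ones : Fin n → ℕ
  ones _ = 1

  zeros : Fin n → ℕ
  zeros _ = 0

  -- The error term is s times a bound for the number of independent sets with fewer than s elements.
  size-bound : ∀ s a p xs →
    (a + s) * weigh zeros 1 p xs ≤ weigh ones a p xs + s * suc (card p xs) ^ s
  size-bound zero a p [] = ≤-reflexive (*-identityʳ (a + 0))
  size-bound zero a p (v ∷ xs) with p v
  ... | false = subst₂ _≤_ (cong ((a + 0) *_) (sym (+-identityʳ _))) (cong (_+ 0) (sym (+-identityʳ _)))
                  (size-bound zero a p xs)
  ... | true = begin
    (a + 0) * (I₀ + I₁)                 ≡⟨ *-distribˡ-+ (a + 0) I₀ I₁ ⟩
    (a + 0) * I₀ + (a + 0) * I₁         ≤⟨ +-monoʳ-≤ ((a + 0) * I₀) (*-monoˡ-≤ I₁ (+-monoˡ-≤ 0 (m≤m+n a 1))) ⟩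
    (a + 0) * I₀ + (a + 1 + 0) * I₁     ≤⟨ +-mono-≤ (size-bound zero a p xs) (size-bound zero (a + 1) (p # v) xs) ⟩
    (F₀ + 0) + (F₁ + 0)                 ≡⟨ cong₂ _+_ (+-identityʳ F₀) refl ⟩
    F₀ + (F₁ + 0)                       ≡⟨ +-assoc F₀ F₁ 0 ⟨
    F₀ + F₁ + 0                         ∎
    where
    open ≤-Reasoning
    I₀ = weigh zeros 1 p xs
    I₁ = weigh zeros 1 (p # v) xs
    F₀ = weigh ones a p xs
    F₁ = weigh ones (a + 1) (p # v) xs
  size-bound (suc s) a p [] rewrite *-identityʳ (a + suc s) | ^-zeroˡ s | *-identityʳ s =
    ≤-refl
  size-bound (suc s) a p (v ∷ xs) with p v
  ... | false = subst₂ (λ x y → (a + suc s) * x ≤ y + suc s * suc (card p xs) ^ suc s)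
                  (sym (+-identityʳ (weigh zeros 1 p xs)))
                  (sym (+-identityʳ (weigh ones a p xs))) (size-bound (suc s) a p xs)
  ... | true = begin
    -- Taking v raises the start value by 1 and lowers the threshold by 1, so their sum is the same
    -- in both branches.
    (a + suc s) * (I₀ + I₁)                             ≡⟨ expand a s I₀ I₁ ⟩
    (a + suc s) * I₀ + (a + 1 + s) * I₁
      ≤⟨ +-mono-≤ (size-bound (suc s) a p xs) (size-bound s (a + 1) (p # v) xs) ⟩
    (F₀ + suc s * suc c ^ suc s) + (F₁ + s * suc (card (p # v) xs) ^ s)
      ≤⟨ +-monoʳ-≤ (F₀ + suc s * suc c ^ suc s) (+-monoʳ-≤ F₁
           (*-mono-≤ (n≤1+n s) (^-monoˡ-≤ s (s≤s (card-mono xs (#⊆ p v)))))) ⟩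
    (F₀ + suc s * suc c ^ suc s) + (F₁ + suc s * suc c ^ s)
      ≡⟨ collect F₀ F₁ (suc s) c (suc c ^ s) ⟩
    F₀ + F₁ + suc s * (suc (suc c) * suc c ^ s)
      ≤⟨ +-monoʳ-≤ (F₀ + F₁) (*-monoʳ-≤ (suc s) (*-monoʳ-≤ (suc (suc c)) (^-monoˡ-≤ s (n≤1+n (suc c))))) ⟩
    F₀ + F₁ + suc s * suc (suc c) ^ suc s ∎
    where
    open ≤-Reasoning
    c = card p xs
    I₀ = weigh zeros 1 p xs
    I₁ = weigh zeros 1 (p # v) xs
    F₀ = weigh ones a p xs
    F₁ = weigh ones (a + 1) (p # v) xs
    expand : ∀ a s x y → (a + suc s) * (x + y) ≡ (a + suc s) * x + (a + 1 + s) * y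
    expand = solve-∀
    collect : ∀ x y s c m → (x + s * (suc c * m)) + (y + s * m) ≡ x + y + s * (suc (suc c) * m)
    collect = solve-∀

  -- Each non-empty set contributes at least 1 to the total size, and the extra 1 stands for the
  -- empty set.
  weigh-ones : ∀ p xs → weigh zeros 1 p xs ≤ weigh ones 0 p xs + 1
  weigh-ones p [] = ≤-refl
  weigh-ones p (v ∷ xs) with p v
  ... | false = subst₂ (λ x y → x ≤ y + 1) (sym (+-identityʳ _)) (sym (+-identityʳ _)) (weigh-ones p xs)
  ... | true = begin
    weigh zeros 1 p xs + weigh zeros 1 (p # v) xs     ≤⟨ +-mono-≤ (weigh-ones p xs) (weigh-mono xs (λ _ _ → z≤n) ≤-refl id) ⟩
    weigh ones 0 p xs + 1 + weigh ones 1 (p # v) xs   ≡⟨ swap (weigh ones 0 p xs) _ ⟩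
    weigh ones 0 p xs + weigh ones 1 (p # v) xs + 1   ∎
    where
    open ≤-Reasoning
    swap : ∀ x y → x + 1 + y ≡ x + y + 1
    swap = solve-∀

  -- The hypothesis makes the error term of `size-bound` at most half of s · I p, so it can be
  -- absorbed and a mean size of at least s / 2 remains.
  average-size : ∀ s p → 2 * suc ∣ p ∣ᵖ ^ s ≤ I p → s * I p ≤ 2 * W ones 0 p
  average-size s p small = +-cancelʳ-≤ (s * I p) _ _ (begin
    s * I p + s * I p                                   ≡⟨ double (s * I p) ⟩
    2 * (s * I p)                                       ≤⟨ *-monoʳ-≤ 2 (size-bound s 0 p V) ⟩
    2 * (W ones 0 p + s * suc ∣ p ∣ᵖ ^ s)               ≡⟨ distrib (W ones 0 p) s _ ⟩
    2 * W ones 0 p + s * (2 * suc ∣ p ∣ᵖ ^ s)           ≤⟨ +-monoʳ-≤ (2 * W ones 0 p) (*-monoʳ-≤ s small) ⟩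
    2 * W ones 0 p + s * I p                            ∎)
    where
    open ≤-Reasoning
    double : ∀ x → x + x ≡ 2 * x
    double = solve-∀
    distrib : ∀ x s y → 2 * (x + s * y) ≡ 2 * x + s * (2 * y)
    distrib = solve-∀

  -- Clique-free sets and lower bounds for their number of independent sets

  CliqueOn IndependentOn : Pred n → Set
  CliqueOn c = ∀ {u v} → c u ≡ true → c v ≡ true → u ≢ v → adj u v ≡ true
  IndependentOn h = ∀ {u v} → h u ≡ true → h v ≡ true → adj u v ≡ false

  -- Relative to a vertex set p, so that r can drop by one on passing to the neighbours of a vertex.
  NoClique : ℕ → Pred n → Set
  NoClique r p = ∀ c → CliqueOn c → c ⊆ p → ∣ c ∣ᵖ ≢ r

  NoClique-⊆ : ∀ {r p q} → p ⊆ q → NoClique r q → NoClique r p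
  NoClique-⊆ p⊆q free c clique c⊆p = free c clique (p⊆q ∘ c⊆p)

  NoClique-zero : ∀ {p} → ¬ NoClique 0 p
  NoClique-zero free = free ∅ (λ ()) (λ ()) (card-∅ V)

  NoClique-adj : ∀ {r p v} → p v ≡ true → NoClique (suc r) p → NoClique r (p ∩ adj v)
  NoClique-adj {r} {p} {v} pv free c clique c⊆ size =
    free (⁅ v ⁆ ∪ c) clique′ sub (trans (card-insert (allFin⁺ n) (∈-allFin v) v∉c) (cong suc size))
    where
    adj-c : ∀ {u} → c u ≡ true → adj v u ≡ true
    adj-c cu = proj₂ (∧-true {p _} (c⊆ cu))
    v∉c : c v ≡ false
    v∉c with c v in cv
    ... | false = refl
    ... | true = contradiction (adj-irrefl v) (true≢false (adj-c cv))
    sub : (⁅ v ⁆ ∪ c) ⊆ p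
    sub {u} m with ∨-true {⁅ v ⁆ u} m
    ... | inj₁ u≡v = subst (λ x → p x ≡ true) (sym (⁅⁆-true u≡v)) pv
    ... | inj₂ cu = proj₁ (∧-true (c⊆ cu))
    clique′ : CliqueOn (⁅ v ⁆ ∪ c)
    clique′ {x} {y} mx my x≢y with ∨-true {⁅ v ⁆ x} mx | ∨-true {⁅ v ⁆ y} my
    ... | inj₁ x≡v | inj₁ y≡v = contradiction (trans (⁅⁆-true x≡v) (sym (⁅⁆-true y≡v))) x≢y
    ... | inj₁ x≡v | inj₂ cy = subst (λ z → adj z y ≡ true) (sym (⁅⁆-true x≡v)) (adj-c cy)
    ... | inj₂ cx | inj₁ y≡v = subst (λ z → adj x z ≡ true) (sym (⁅⁆-true y≡v))
                                 (trans (adj-sym x v) (adj-c cx))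
    ... | inj₂ cx | inj₂ cy = clique cx cy x≢y

  card-delete : ∀ p v → ∣ p ∣ᵖ ≤ suc ∣ p - v ∣ᵖ
  card-delete p v = ≤-trans
    (card-cover {p = p} {⁅ v ⁆} {p - v} V cover)
    (≤-reflexive (cong (_+ ∣ p - v ∣ᵖ) (card-singleton (allFin⁺ n) (∈-allFin v))))
    where
    cover : ∀ {u} → p u ≡ true → ⁅ v ⁆ u ≡ true ⊎ (p - v) u ≡ true
    cover {u} pu with ⁅ v ⁆ u
    ... | true = inj₁ refl
    ... | false = inj₂ (∧-intro pu refl)

  card-neighbours : ∀ p v → ∣ p ∣ᵖ ≤ suc (∣ p ∩ adj v ∣ᵖ + ∣ p # v ∣ᵖ)
  card-neighbours p v = ≤-trans (card-delete p v)
    (s≤s (card-cover {p = p - v} {p ∩ adj v} {p # v} V cover))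
    where
    cover : ∀ {u} → (p - v) u ≡ true → (p ∩ adj v) u ≡ true ⊎ (p # v) u ≡ true
    cover {u} m with ∧-true {p u} m | adj v u
    ... | pu , _ | true = inj₁ (∧-intro pu refl)
    ... | pu , u≢v | false = inj₂ (∧-intro pu (∧-intro u≢v refl))

  -- The usual Ramsey recursion, except that the number of independent sets is doubled where an
  -- independent set would gain a vertex. If v has many non-neighbours, each independent set of them
  -- counts both with and without v. Otherwise v has many neighbours, among which the clique bound
  -- is smaller by one.
  ramsey : ∀ r k p → NoClique r p → suc k ^ r ≤ suc ∣ p ∣ᵖ → 2 ^ k ≤ I p
  ramsey zero k p free _ = contradiction free NoClique-zero
  ramsey (suc r) zero p free _ = I-positive p
  ramsey (suc r) (suc k) p free large = case ≤-total (suc k ^ suc r) (suc ∣ p # v ∣ᵖ) of λ where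
      (inj₁ large#) → ≤-trans (≤-reflexive (double (2 ^ k)))
        (grow (ramsey (suc r) k (p # v) (NoClique-⊆ (#⊆ p v) free) large#))
      (inj₂ small#) → ≤-trans
        (ramsey r (suc k) (p ∩ adj v) (NoClique-adj pv free)
          (+-cancelʳ-≤ (suc k * 2+k^r) _ _ (begin
            -- The power (k + 2)^(r + 1) is split into k + 2 copies of (k + 2)^r: k + 1 of them pay
            -- for the non-neighbours, one is left for the neighbours.
            2+k^r + suc k * 2+k^r                           ≤⟨ large ⟩
            suc ∣ p ∣ᵖ                                      ≤⟨ s≤s (card-neighbours p v) ⟩
            suc (suc (∣ p ∩ adj v ∣ᵖ + ∣ p # v ∣ᵖ))         ≡⟨ cong suc (+-suc _ _) ⟨
            suc ∣ p ∩ adj v ∣ᵖ + suc ∣ p # v ∣ᵖ             ≤⟨ +-monoʳ-≤ (suc ∣ p ∩ adj v ∣ᵖ) small# ⟩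
            suc ∣ p ∩ adj v ∣ᵖ + suc k * suc k ^ r          ≤⟨ +-monoʳ-≤ (suc ∣ p ∩ adj v ∣ᵖ)
                                                                 (*-monoʳ-≤ (suc k) (^-monoˡ-≤ r (n≤1+n (suc k)))) ⟩
            suc ∣ p ∩ adj v ∣ᵖ + suc k * 2+k^r              ∎)))
        (I-mono {p ∩ adj v} {p} (λ m → proj₁ (∧-true m)))
    where
    open ≤-Reasoning
    2+k^r = suc (suc k) ^ r
    nonempty : ∃ λ v → p v ≡ true
    nonempty = card-nonempty V (s≤s⁻¹ (≤-trans (s≤s (s≤s z≤n))
      (≤-trans (^-monoʳ-≤ (suc (suc k)) {1} {suc r} (s≤s z≤n)) large)))
    v = proj₁ nonempty
    pv = proj₂ nonempty
    double : ∀ x → 2 * x ≡ x + x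
    double = solve-∀
    grow : ∀ {m} → m ≤ I (p # v) → m + m ≤ I p
    grow {m} m≤ = begin
      m + m                   ≤⟨ +-mono-≤ m≤ m≤ ⟩
      I (p # v) + I (p # v)   ≤⟨ +-monoˡ-≤ (I (p # v)) (I-mono {p # v} {p - v} λ {u} mu →
                                   ∧-intro (#⊆ p v mu) (proj₁ (∧-true (proj₂ (∧-true {p u} mu))))) ⟩
      I (p - v) + I (p # v)   ≡⟨ W-split {zeros} pv ⟨
      I p                     ∎

  -- A vertex that fails has more than r · t neighbours in p, where the clique bound is one smaller;
  -- failing at every level would build a forbidden clique. A vertex that succeeds among these
  -- neighbours also succeeds in p.
  turán : ∀ r t p → NoClique r p → r * t < ∣ p ∣ᵖ → ∃ λ v → p v ≡ true × t ≤ ∣ p # v ∣ᵖ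
  turán zero t p free _ = contradiction free NoClique-zero
  turán (suc r) t p free large with card-nonempty V (≤-trans (s≤s z≤n) large)
  ... | v , pv with t ≤? ∣ p # v ∣ᵖ
  ... | yes t≤ = v , pv , t≤
  ... | no t≰ = case turán r t (p ∩ adj v) (NoClique-adj pv free) large′ of λ where
      (u , pu , t≤) → u , proj₁ (∧-true pu) ,
        ≤-trans t≤ (card-mono V λ {y} m → case ∧-true {p y ∧ adj v y} m of λ where
          (m₁ , m₂) → ∧-intro (proj₁ (∧-true {p y} m₁)) m₂)
    where
    open ≤-Reasoning
    large′ : r * t < ∣ p ∩ adj v ∣ᵖ
    large′ = +-cancelʳ-≤ t _ _ (begin
      suc (r * t) + t                           ≡⟨ cong suc (+-comm (r * t) t) ⟩
      suc (suc r * t)                           ≤⟨ large ⟩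
      ∣ p ∣ᵖ                                    ≤⟨ card-neighbours p v ⟩
      suc (∣ p ∩ adj v ∣ᵖ + ∣ p # v ∣ᵖ)         ≡⟨ +-suc _ _ ⟨
      ∣ p ∩ adj v ∣ᵖ + suc ∣ p # v ∣ᵖ           ≤⟨ +-monoʳ-≤ _ (≰⇒> t≰) ⟩
      ∣ p ∩ adj v ∣ᵖ + t                        ∎)

  -- The independent sets are sorted by the first of j successive Turán vertices that they contain:
  -- those with v are counted by `I (p # v)`, the rest live in `p - v`. The margin j above r · t
  -- keeps a Turán vertex available after each deletion.
  many-sets : ∀ r t g → (∀ p → NoClique r p → t ≤ ∣ p ∣ᵖ → g ≤ I p) →
    ∀ j p → NoClique r p → r * t + j ≤ ∣ p ∣ᵖ → j * g ≤ I p
  many-sets r t g lower zero p _ _ = z≤n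
  many-sets r t g lower (suc j) p free large with turán r t p free
    (≤-trans (s≤s (m≤m+n (r * t) j)) (≤-trans (≤-reflexive (sym (+-suc (r * t) j))) large))
  ... | v , pv , t≤ = begin
    g + j * g                 ≤⟨ +-mono-≤ (lower (p # v) (NoClique-⊆ (#⊆ p v) free) t≤)
                                   (many-sets r t g lower j (p - v) (NoClique-⊆ (-⊆ p v) free) large′) ⟩
    I (p # v) + I (p - v)     ≡⟨ +-comm (I (p # v)) (I (p - v)) ⟩
    I (p - v) + I (p # v)     ≡⟨ W-split {zeros} pv ⟨
    I p                       ∎
    where
    open ≤-Reasoning
    large′ : r * t + j ≤ ∣ p - v ∣ᵖ
    large′ = s≤s⁻¹ (≤-trans (≤-reflexive (sym (+-suc (r * t) j))) (≤-trans large (card-delete p v)))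

  -- With D = R + 1, a set of at least 2^(mD) vertices admits 2^(mD-1) successive choices of a vertex
  -- with at least 2^((m-1)D) non-neighbours.  Multiplied over m, these give 2^(m²D/2) sets.
  quadratic-growth : ∀ r R p m → NoClique r p → r ≤ 2 ^ R → 1 ≤ R →
    2 ^ (m * suc R) ≤ ∣ p ∣ᵖ → 2 ^ (m * m * suc R) ≤ I p * I p
  quadratic-growth r R p m free r≤ 1≤R large = begin
    2 ^ (m * m * suc R)               ≤⟨ ^-monoʳ-≤ 2 (exponent-bound m) ⟩
    2 ^ (exponent m + exponent m)     ≡⟨ ^-distribˡ-+-* 2 (exponent m) (exponent m) ⟩
    2 ^ exponent m * 2 ^ exponent m   ≤⟨ *-mono-≤ (go m p free large) (go m p free large) ⟩
    I p * I p                         ∎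
    where
    open ≤-Reasoning
    exponent : ℕ → ℕ
    exponent zero = 0
    exponent (suc m) = (m * suc R + R) + exponent m
    exponent-bound : ∀ m → m * m * suc R ≤ exponent m + exponent m
    exponent-bound zero = z≤n
    exponent-bound (suc m) = begin
      suc m * suc m * suc R                                 ≡⟨ e₁ m R ⟩
      (m * suc R + m * suc R) + (R + 1) + m * m * suc R     ≤⟨ +-mono-≤ (+-monoʳ-≤ (m * suc R + m * suc R) (+-monoʳ-≤ R 1≤R)) (exponent-bound m) ⟩
      (m * suc R + m * suc R) + (R + R) + (exponent m + exponent m)
                                                            ≡⟨ e₂ (m * suc R) R (exponent m) ⟩
      exponent (suc m) + exponent (suc m)                   ∎
      where
      e₁ : ∀ m R → suc m * suc m * suc R ≡ (m * suc R + m * suc R) + (R + 1) + m * m * suc R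
      e₁ = solve-∀
      e₂ : ∀ a R e → (a + a) + (R + R) + (e + e) ≡ (a + R + e) + (a + R + e)
      e₂ = solve-∀
    go : ∀ m p → NoClique r p → 2 ^ (m * suc R) ≤ ∣ p ∣ᵖ → 2 ^ exponent m ≤ I p
    go zero p _ _ = I-positive p
    go (suc m) p free large = begin
      2 ^ (m * suc R + R + exponent m)          ≡⟨ ^-distribˡ-+-* 2 (m * suc R + R) (exponent m) ⟩
      2 ^ (m * suc R + R) * 2 ^ exponent m      ≤⟨ many-sets r (2 ^ (m * suc R)) (2 ^ exponent m) (go m)
                                                     (2 ^ (m * suc R + R)) p free (≤-trans room large) ⟩
      I p                                       ∎
      where
      -- Since r is at most 2^R, half of the 2^((m+1)D) vertices covers the Turán threshold and the
      -- other half is free for the choices. This halving is why D exceeds R by one.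
      room : r * 2 ^ (m * suc R) + 2 ^ (m * suc R + R) ≤ 2 ^ (suc m * suc R)
      room = begin
        r * 2 ^ (m * suc R) + 2 ^ (m * suc R + R)       ≤⟨ +-monoˡ-≤ _ (*-monoˡ-≤ (2 ^ (m * suc R)) r≤) ⟩
        2 ^ R * 2 ^ (m * suc R) + 2 ^ (m * suc R + R)   ≡⟨ cong (_+ 2 ^ (m * suc R + R)) (^-distribˡ-+-* 2 R (m * suc R)) ⟨
        2 ^ (R + m * suc R) + 2 ^ (m * suc R + R)       ≡⟨ cong (λ e → 2 ^ (R + m * suc R) + 2 ^ e) (+-comm (m * suc R) R) ⟩
        2 ^ (R + m * suc R) + 2 ^ (R + m * suc R)       ≡⟨ cong (2 ^ (R + m * suc R) +_) (+-identityʳ _) ⟨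
        2 ^ suc (R + m * suc R)                         ∎

  -- Shearer's averaging over closed neighbourhoods

  -- Summed over W this is d [v ∈ W] + |N(v) ∩ W|, whose sum over v is at most 2d |W|.
  incidence : ℕ → Fin n → Fin n → ℕ
  incidence d v u = gate (⁅ v ⁆ u) d + gate (adj v u) 1

  -- Splitting along zs reveals the part of W outside the closed neighbourhood of v; what remains is v
  -- together with the neighbours of v that have no neighbour in that part.
  conditioning : ∀ s d v → (∀ p → p ⊆ adj v → s * suc (I p) ≤ 4 * (d + W ones 0 p)) →
    ∀ zs p → p v ≡ true → (∀ {u} → p u ≡ true → (⁅ v ⁆ u ≡ true ⊎ adj v u ≡ true) ⊎ u ∈ zs) →
    s * I p ≤ 4 * W (incidence d v) 0 p
  conditioning s d v local [] p pv closed = begin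
    s * I p                                         ≡⟨ cong (s *_) (W-split {zeros} pv) ⟩
    s * (I (p - v) + I (p # v))                     ≡⟨ cong (λ k → s * (I (p - v) + k)) (weigh-∅ V (λ _ → p#v-empty)) ⟩
    s * (I (p - v) + 1)                             ≡⟨ cong (s *_) (+-comm (I (p - v)) 1) ⟩
    s * suc (I (p - v))                             ≤⟨ local (p - v) inside-adj ⟩
    4 * (d + W ones 0 (p - v))                      ≤⟨ *-monoʳ-≤ 4 (+-mono-≤ at-v (weigh-mono V in-adj ≤-refl id)) ⟩
    4 * (W (incidence d v) (incidence d v v) (p # v) + W (incidence d v) 0 (p - v))
                                                    ≡⟨ cong (4 *_) (trans (+-comm (W (incidence d v) (incidence d v v) (p # v)) _)
                                                                     (sym (W-split {incidence d v} pv))) ⟩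
    4 * W (incidence d v) 0 p                       ∎
    where
    open ≤-Reasoning
    inside-adj : (p - v) ⊆ adj v
    inside-adj {u} m with ∧-true {p u} m
    ... | pu , u≢v with closed pu
    ... | inj₁ (inj₁ u≡v) = contradiction (not-true u≢v) (true≢false u≡v)
    ... | inj₁ (inj₂ v~u) = v~u
    p#v-empty : ∀ {u} → (p # v) u ≡ false
    p#v-empty {u} with p u in pu
    ... | false = refl
    ... | true with closed pu
    ... | inj₁ (inj₁ u≡v) rewrite u≡v = refl
    ... | inj₁ (inj₂ v~u) rewrite v~u = ∧-zeroʳ _
    at-v : d ≤ W (incidence d v) (incidence d v v) (p # v)
    at-v = begin
      d                                               ≤⟨ m≤m+n d _ ⟩
      d + gate (adj v v) 1                            ≡⟨ cong (λ b → gate b d + gate (adj v v) 1) (⁅⁆-self v) ⟨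
      incidence d v v                                 ≤⟨ weigh-lower _ _ _ V ⟩
      W (incidence d v) (incidence d v v) (p # v)     ∎
    in-adj : ∀ u → (p - v) u ≡ true → 1 ≤ incidence d v u
    in-adj u m rewrite inside-adj {u} m = m≤n+m 1 _
  conditioning s d v local (u ∷ zs) p pv closed with p u in pu | sep v u in v#u
  ... | false | _ = conditioning s d v local zs p pv λ {x} px → case closed px of λ where
      (inj₁ near) → inj₁ near
      (inj₂ (here refl)) → contradiction pu (true≢false px)
      (inj₂ (there x∈)) → inj₂ x∈
  ... | true | false = conditioning s d v local zs p pv λ {x} px → case closed px of λ where
      (inj₁ near) → inj₁ near
      (inj₂ (here refl)) → inj₁ (near (⁅ v ⁆ u) (adj v u) v#u)
      (inj₂ (there x∈)) → inj₂ x∈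
    where
    near : ∀ a b → not a ∧ not b ≡ false → a ≡ true ⊎ b ≡ true
    near true _ _ = inj₁ refl
    near false true _ = inj₂ refl
  ... | true | true = begin
    s * I p                                             ≡⟨ cong (s *_) (W-split {zeros} pu) ⟩
    s * (I (p - u) + I (p # u))                         ≡⟨ *-distribˡ-+ s (I (p - u)) (I (p # u)) ⟩
    s * I (p - u) + s * I (p # u)
      ≤⟨ +-mono-≤ (conditioning s d v local zs (p - u) v∈₁ closed₁)
                  (conditioning s d v local zs (p # u) v∈₂ closed₂) ⟩
    4 * W w 0 (p - u) + 4 * W w 0 (p # u)               ≡⟨ *-distribˡ-+ 4 (W w 0 (p - u)) (W w 0 (p # u)) ⟨
    -- The weight of u itself is not collected: starting from 0 instead of `w u` can only lower the
    -- sum.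
    4 * (W w 0 (p - u) + W w 0 (p # u))                 ≤⟨ *-monoʳ-≤ 4 (+-monoʳ-≤ (W w 0 (p - u)) (weigh-mono V (λ _ _ → ≤-refl) z≤n id)) ⟩
    4 * (W w 0 (p - u) + W w (w u) (p # u))             ≡⟨ cong (4 *_) (W-split {w} pu) ⟨
    4 * W w 0 p                                         ∎
    where
    open ≤-Reasoning
    w = incidence d v
    u#v : sep u v ≡ true
    u#v = trans (sep-sym u v) v#u
    v∈₁ : (p - u) v ≡ true
    v∈₁ = ∧-intro pv (proj₁ (∧-true u#v))
    v∈₂ : (p # u) v ≡ true
    v∈₂ = ∧-intro pv u#v
    closed₁ : ∀ {x} → (p - u) x ≡ true → (⁅ v ⁆ x ≡ true ⊎ adj v x ≡ true) ⊎ x ∈ zs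
    closed₁ {x} m with ∧-true {p x} m
    ... | px , x≢u with closed px
    ... | inj₁ near = inj₁ near
    ... | inj₂ (here refl) = contradiction (not-true x≢u) (true≢false (⁅⁆-self x))
    ... | inj₂ (there x∈) = inj₂ x∈
    closed₂ : ∀ {x} → (p # u) x ≡ true → (⁅ v ⁆ x ≡ true ⊎ adj v x ≡ true) ⊎ x ∈ zs
    closed₂ {x} m = closed₁ (∧-intro (#⊆ p u m) (proj₁ (∧-true (proj₂ (∧-true {p x} m)))))

  weigh-zeros : ∀ p xs → weigh zeros 0 p xs ≡ 0
  weigh-zeros p [] = refl
  weigh-zeros p (v ∷ xs) with p v
  ... | false = trans (+-identityʳ _) (weigh-zeros p xs)
  ... | true = cong₂ _+_ (weigh-zeros p xs) (weigh-zeros (p # v) xs)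

  weigh-+ : ∀ w w′ a a′ p xs →
    weigh (λ u → w u + w′ u) (a + a′) p xs ≡ weigh w a p xs + weigh w′ a′ p xs
  weigh-+ w w′ a a′ p [] = refl
  weigh-+ w w′ a a′ p (v ∷ xs) with p v
  ... | false = trans (+-identityʳ _) (trans (weigh-+ w w′ a a′ p xs)
                  (sym (cong₂ _+_ (+-identityʳ (weigh w a p xs)) (+-identityʳ (weigh w′ a′ p xs)))))
  ... | true = trans
      (cong₂ _+_ (weigh-+ w w′ a a′ p xs)
        (trans (weigh-cong xs (swap a a′ (w v) (w′ v)) λ _ → refl)
          (weigh-+ w w′ (a + w v) (a′ + w′ v) (p # v) xs)))
      (swap (weigh w a p xs) _ _ _)
    where
    swap : ∀ x y z t → (x + y) + (z + t) ≡ (x + z) + (y + t)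
    swap = solve-∀

  weigh-sum : ∀ (w : Fin n → Fin n → ℕ) p vs →
    W (λ u → sum (map (λ v → w v u) vs)) 0 p ≡ sum (map (λ v → W (w v) 0 p) vs)
  weigh-sum w p [] = weigh-zeros p V
  weigh-sum w p (v ∷ vs) = trans (weigh-+ (w v) _ 0 0 p V) (cong (W (w v) 0 p +_) (weigh-sum w p vs))

  sum-incidence : ∀ d u xs →
    sum (map (λ v → incidence d v u) xs) ≡ d * card ⁅ u ⁆ xs + card (adj u) xs
  sum-incidence d u [] = sym (trans (+-identityʳ _) (*-zeroʳ d))
  sum-incidence d u (v ∷ xs) rewrite sum-incidence d u xs = trans
    (cong₂ (λ a b → gate a d + gate b 1 + (d * card ⁅ u ⁆ xs + card (adj u) xs)) (⁅⁆-sym v u) (adj-sym v u))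
    (trans (cong (λ k → k + gate (adj u v) 1 + (d * card ⁅ u ⁆ xs + card (adj u) xs)) (gate-* (⁅ u ⁆ v)))
      (collect d (gate (⁅ u ⁆ v) 1) (gate (adj u v) 1) (card ⁅ u ⁆ xs) (card (adj u) xs)))
    where
    gate-* : ∀ b → gate b d ≡ d * gate b 1
    gate-* true = sym (*-identityʳ d)
    gate-* false = sym (*-zeroʳ d)
    collect : ∀ d x y c e → d * x + y + (d * c + e) ≡ d * (x + c) + (y + e)
    collect = solve-∀

  -- Seen from u, the weight d occurs once, for v = u, and a weight 1 occurs for each neighbour of
  -- u.
  incidence-bound : ∀ {d} → MaxDegreeAtMost d G → ∀ u →
    sum (map (λ v → incidence d v u) V) ≤ 2 * d
  incidence-bound {d} deg u = begin
    sum (map (λ v → incidence d v u) V)       ≡⟨ sum-incidence d u V ⟩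
    d * ∣ ⁅ u ⁆ ∣ᵖ + ∣ adj u ∣ᵖ               ≡⟨ cong₂ (λ x y → d * x + y) (card-singleton (allFin⁺ n) (∈-allFin u)) (card-tabulate (adj u) id) ⟩
    d * 1 + Graph.degree G u                  ≤⟨ +-monoʳ-≤ (d * 1) (deg u) ⟩
    d * 1 + d                                 ≡⟨ double d ⟩
    2 * d                                     ∎
    where
    open ≤-Reasoning
    double : ∀ d → d * 1 + d ≡ 2 * d
    double = solve-∀

  independent-card : ∀ h → IndependentOn h → ∣ h ∣ᵖ ≤ α G
  independent-card h indep = begin
    ∣ h ∣ᵖ       ≡⟨ card-tabulate h id ⟩
    ∣ ⟦ h ⟧ ∣    ≤⟨ v≤max⁺ 0 _ (inj₂ (Any.map ≤-reflexive
                      (∈-map⁺ ∣_∣ (∈-filter⁺ (Graph.independent? G) (∈-subsets ⟦ h ⟧)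
                        λ u v u∈ v∈ → does-false (u ~? v) (indep (∈⟦⟧ u∈) (∈⟦⟧ v∈)))))) ⟩
    α G          ∎
    where open ≤-Reasoning

  -- Here h is the set chosen so far and the start value is its weight, so at the end of the list
  -- every summand is k times the size of an independent set. The separation of h from p keeps h
  -- independent as it grows.
  α-average : ∀ k h p xs → IndependentOn h → (∀ {u v} → h u ≡ true → p v ≡ true → sep u v ≡ true) →
    weigh (λ _ → k) (k * ∣ h ∣ᵖ) p xs ≤ k * α G * weigh zeros 1 p xs
  α-average k h p [] indep _ = ≤-trans (*-monoʳ-≤ k (independent-card h indep)) (≤-reflexive (sym (*-identityʳ _)))
  α-average k h p (v ∷ xs) indep apart with p v in pv
  ... | false = subst₂ _≤_ (sym (+-identityʳ _)) (cong (k * α G *_) (sym (+-identityʳ _)))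
                  (α-average k h p xs indep apart)
  ... | true = begin
    weigh (λ _ → k) (k * ∣ h ∣ᵖ) p xs + weigh (λ _ → k) (k * ∣ h ∣ᵖ + k) (p # v) xs
      ≡⟨ cong (weigh (λ _ → k) (k * ∣ h ∣ᵖ) p xs +_) (weigh-cong xs size λ _ → refl) ⟩
    weigh (λ _ → k) (k * ∣ h ∣ᵖ) p xs + weigh (λ _ → k) (k * ∣ ⁅ v ⁆ ∪ h ∣ᵖ) (p # v) xs
      ≤⟨ +-mono-≤ (α-average k h p xs indep apart) (α-average k (⁅ v ⁆ ∪ h) (p # v) xs indep′ apart′) ⟩
    k * α G * weigh zeros 1 p xs + k * α G * weigh zeros 1 (p # v) xs
      ≡⟨ *-distribˡ-+ (k * α G) (weigh zeros 1 p xs) _ ⟨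
    k * α G * (weigh zeros 1 p xs + weigh zeros 1 (p # v) xs) ∎
    where
    open ≤-Reasoning
    v∉h : h v ≡ false
    v∉h with h v in hv
    ... | false = refl
    ... | true = contradiction (sep-self v) (true≢false (apart hv pv))
    size : k * ∣ h ∣ᵖ + k ≡ k * ∣ ⁅ v ⁆ ∪ h ∣ᵖ
    size = trans (trans (+-comm (k * ∣ h ∣ᵖ) k) (sym (*-suc k ∣ h ∣ᵖ)))
      (cong (k *_) (sym (card-insert (allFin⁺ n) (∈-allFin v) v∉h)))
    sep⇒nonadj : ∀ {x y} → sep x y ≡ true → adj x y ≡ false
    sep⇒nonadj {x} {y} s = not-true (proj₂ (∧-true {not (⁅ x ⁆ y)} s))
    indep′ : IndependentOn (⁅ v ⁆ ∪ h)
    indep′ {x} {y} mx my with ∨-true {⁅ v ⁆ x} mx | ∨-true {⁅ v ⁆ y} my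
    ... | inj₂ hx | inj₂ hy = indep hx hy
    ... | inj₂ hx | inj₁ y≡v rewrite ⁅⁆-true {u = y} {v} y≡v = sep⇒nonadj (apart hx pv)
    ... | inj₁ x≡v | inj₂ hy rewrite ⁅⁆-true {u = x} {v} x≡v = trans (adj-sym v y) (sep⇒nonadj (apart hy pv))
    ... | inj₁ x≡v | inj₁ y≡v rewrite ⁅⁆-true {u = x} {v} x≡v | ⁅⁆-true {u = y} {v} y≡v = adj-irrefl v
    apart′ : ∀ {x y} → (⁅ v ⁆ ∪ h) x ≡ true → (p # v) y ≡ true → sep x y ≡ true
    apart′ {x} {y} mx py with ∨-true {⁅ v ⁆ x} mx | ∧-true {p y} py
    ... | inj₁ x≡v | _ , v#y rewrite ⁅⁆-true {u = x} {v} x≡v = v#y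
    ... | inj₂ hx | py , _ = apart hx py

  sum-lower : ∀ {k} (f : Fin n → ℕ) xs → (∀ v → k ≤ f v) → length xs * k ≤ sum (map f xs)
  sum-lower f [] _ = z≤n
  sum-lower f (v ∷ xs) k≤ = +-mono-≤ (k≤ v) (sum-lower f xs k≤)

  sum-* : ∀ k (f : Fin n → ℕ) xs → sum (map (λ v → k * f v) xs) ≡ k * sum (map f xs)
  sum-* k f [] = sym (*-zeroʳ k)
  sum-* k f (v ∷ xs) = trans (cong (k * f v +_) (sum-* k f xs)) (sym (*-distribˡ-+ k (f v) _))

  all : Pred n
  all _ = true

  -- Adding up `conditioning` over all v and exchanging the sums bounds n · s · I by 4 · 2d times
  -- the total size of the independent sets, and each of these has at most α elements.
  shearer : ∀ s d → MaxDegreeAtMost d G →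
    (∀ v p → p ⊆ adj v → s * suc (I p) ≤ 4 * (d + W ones 0 p)) → n * s ≤ 8 * d * α G
  shearer s d deg local = *-cancelʳ-≤ (n * s) (8 * d * α G) (I all) ⦃ >-nonZero (I-positive all) ⦄ (begin
    n * s * I all                                               ≡⟨ *-assoc n s (I all) ⟩
    n * (s * I all)                                             ≡⟨ cong (_* (s * I all)) (length-tabulate {n = n} id) ⟨
    length V * (s * I all)
      ≤⟨ sum-lower (λ v → 4 * W (incidence d v) 0 all) V
           (λ v → conditioning s d v (local v) V all refl (λ _ → inj₂ (∈-allFin _))) ⟩
    sum (map (λ v → 4 * W (incidence d v) 0 all) V)             ≡⟨ sum-* 4 (λ v → W (incidence d v) 0 all) V ⟩
    4 * sum (map (λ v → W (incidence d v) 0 all) V)             ≡⟨ cong (4 *_) (weigh-sum (incidence d) all V) ⟨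
    4 * W (λ u → sum (map (λ v → incidence d v u) V)) 0 all
      ≤⟨ *-monoʳ-≤ 4 (weigh-mono V (λ u _ → incidence-bound deg u) ≤-refl id) ⟩
    4 * W (λ _ → 2 * d) 0 all                                   ≤⟨ *-monoʳ-≤ 4 (weigh-mono V (λ _ _ → ≤-refl) z≤n id) ⟩
    4 * W (λ _ → 2 * d) (2 * d * ∣ ∅ ∣ᵖ) all                     ≤⟨ *-monoʳ-≤ 4 (α-average (2 * d) ∅ all V (λ ()) (λ ())) ⟩
    4 * (2 * d * α G * I all)                                   ≡⟨ reassoc d (α G) (I all) ⟩
    8 * d * α G * I all                                         ∎)
    where
    open ≤-Reasoning
    reassoc : ∀ d a i → 4 * (2 * d * a * i) ≡ 8 * d * a * i
    reassoc = solve-∀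

  NoClique-graph : ∀ {r} → CliqueFree r G → ∀ p → NoClique r p
  NoClique-graph free p c clique _ size = free ⟦ c ⟧ (trans (sym (card-tabulate c id)) size)
    λ u v u∈ v∈ u≢v → does-true (u ~? v) (clique (∈⟦⟧ u∈) (∈⟦⟧ v∈) u≢v)

-- Numerical estimates

n<2^n : ∀ n → n < 2 ^ n
n<2^n zero = s≤s z≤n
n<2^n (suc n) = begin-strict
  suc n                 ≤⟨ n<2^n n ⟩
  2 ^ n                 <⟨ m<m+n (2 ^ n) (m^n>0 2 n) ⟩
  2 ^ n + 2 ^ n         ≡⟨ cong (2 ^ n +_) (+-identityʳ (2 ^ n)) ⟨
  2 ^ suc n             ∎
  where open ≤-Reasoning

m<[1+m/n]*n : ∀ m n .{{_ : NonZero n}} → m < suc (m / n) * n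
m<[1+m/n]*n m n = begin-strict
  m                       ≡⟨ m≡m%n+[m/n]*n m n ⟩
  m % n + m / n * n       <⟨ +-monoˡ-< (m / n * n) (m%n<n m n) ⟩
  n + m / n * n           ∎
  where open ≤-Reasoning

2^-cancel-< : ∀ {a b} → 2 ^ a < 2 ^ b → a < b
2^-cancel-< {a} {b} lt with a <? b
... | yes a<b = a<b
... | no a≮b = contradiction lt (≤⇒≯ (^-monoʳ-≤ 2 (≮⇒≥ a≮b)))

square-cancel-≤ : ∀ {x y} → x * x ≤ y * y → x ≤ y
square-cancel-≤ {x} {y} le with x ≤? y
... | yes x≤y = x≤y
... | no x≰y = contradiction le (<⇒≱ (*-mono-< (≰⇒> x≰y) (≰⇒> x≰y)))

floor-log : ∀ m → 1 ≤ m → ∃ λ a → 2 ^ a ≤ m × m < 2 ^ suc a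
floor-log 1 _ = 0 , s≤s z≤n , s≤s (s≤s z≤n)
floor-log (suc (suc m)) _ with floor-log (suc m) (s≤s z≤n)
... | a , lower , upper with suc (suc m) <? 2 ^ suc a
... | yes lt = a , m≤n⇒m≤1+n lower , lt
... | no ≮ = suc a , ≮⇒≥ ≮ , ≤-<-trans upper (^-monoʳ-< 2 (s≤s (s≤s z≤n)) (n<1+n (suc a)))

-- This is how a target of order log d is beaten by √d when there are few independent sets.
suc-square≤16*2^ : ∀ k → suc k * suc k ≤ 16 * 2 ^ k
suc-square≤16*2^ zero = s≤s z≤n
suc-square≤16*2^ (suc k) = begin
  suc (suc k) * suc (suc k)         ≡⟨ e₁ k ⟩
  suc k * suc k + (2 * suc k + 1)   ≤⟨ +-mono-≤ (suc-square≤16*2^ k) (+-mono-≤ (*-monoʳ-≤ 2 (n<2^n k)) (m^n>0 2 k)) ⟩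
  16 * 2 ^ k + (2 * 2 ^ k + 2 ^ k)  ≤⟨ m≤m+n _ (13 * 2 ^ k) ⟩
  16 * 2 ^ k + (2 * 2 ^ k + 2 ^ k) + 13 * 2 ^ k  ≡⟨ e₂ (2 ^ k) ⟩
  16 * 2 ^ suc k                    ∎
  where
  open ≤-Reasoning
  e₁ : ∀ k → suc (suc k) * suc (suc k) ≡ suc k * suc k + (2 * suc k + 1)
  e₁ = solve-∀
  e₂ : ∀ x → 16 * x + (2 * x + x) + 13 * x ≡ 16 * (2 * x)
  e₂ = solve-∀

-- With a for log I, l for log d and b for log l, a may be far larger than l, so log a need not be
-- bounded by a multiple of b. The quotient q of a + 2 by l measures the excess. It enters linearly,
-- which a can afford: b + 2 + q is at most b (q + 3), and (l + 1)(q + 3) is at most 8a + 10.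
ramsey-exponent : ∀ {r s l b a q} → 1 ≤ b → 2 ≤ a → l ≤ 2 * a + 1 → 1 ≤ l → q * l ≤ a + 2 →
  32 * (s * (r * b)) ≤ l + 1 → suc ((b + 2 + q) * (r * s)) ≤ a
ramsey-exponent {r} {s} {l} {b} {a} {q} 1≤b 2≤a l≤ 1≤l ql≤ H = *-cancelˡ-≤ 32 (begin
  32 * suc ((b + 2 + q) * (r * s))                  ≤⟨ *-monoʳ-≤ 32 (s≤s (*-monoˡ-≤ (r * s) (≤-trans
                                                          (≤-reflexive (+-assoc b 2 q)) (+-mono-≤ (≤-reflexive (sym (*-identityʳ b)))
                                                            (≤-trans (≤-reflexive (sym (*-identityˡ (2 + q))))
                                                              (*-monoˡ-≤ (2 + q) 1≤b)))))) ⟩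
  32 * suc ((b * 1 + b * (2 + q)) * (r * s))        ≡⟨ e₁ b q r s ⟩
  32 + 32 * (s * (r * b)) * (q + 3)                 ≤⟨ +-monoʳ-≤ 32 (*-monoˡ-≤ (q + 3) H) ⟩
  32 + (l + 1) * (q + 3)                            ≡⟨ e₂ l q ⟩
  35 + q * l + q * 1 + 3 * l                        ≤⟨ +-mono-≤ (+-mono-≤ (+-monoʳ-≤ 35 ql≤) (≤-trans (*-monoʳ-≤ q 1≤l) ql≤)) (*-monoʳ-≤ 3 l≤) ⟩
  35 + (a + 2) + (a + 2) + 3 * (2 * a + 1)          ≡⟨ e₃ a ⟩
  42 + 8 * a                                        ≤⟨ +-monoˡ-≤ (8 * a) (≤-trans (m≤n+m 42 6) (*-monoʳ-≤ 24 2≤a)) ⟩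
  24 * a + 8 * a                                    ≡⟨ e₄ a ⟩
  32 * a                                            ∎)
  where
  open ≤-Reasoning
  e₁ : ∀ b q r s → 32 * suc ((b * 1 + b * (2 + q)) * (r * s)) ≡ 32 + 32 * (s * (r * b)) * (q + 3)
  e₁ = solve-∀
  e₂ : ∀ l q → 32 + (l + 1) * (q + 3) ≡ 35 + q * l + q * 1 + 3 * l
  e₂ = solve-∀
  e₃ : ∀ a → 35 + (a + 2) + (a + 2) + 3 * (2 * a + 1) ≡ 42 + 8 * a
  e₃ = solve-∀
  e₄ : ∀ a → 24 * a + 8 * a ≡ 32 * a
  e₄ = solve-∀

-- 9 (s(m+1)D)² = 9 (s²D) ((m+1)²D) ≤ (a+1)², where s²D is small by hypothesis and
-- (m+1)²D ≤ 2m²D + 2D.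
growth-exponent : ∀ {s m l ρ a} → 1 ≤ s → 1 ≤ ρ → 2 ≤ a → l ≤ 2 * a + 1 →
  m * m * suc (suc ρ) ≤ 2 * (a + 1) → 1024 * (s * s * ρ) ≤ 4 * (l + 1) →
  suc (suc m * suc (suc ρ) * s) ≤ a
growth-exponent {s} {m} {l} {ρ} {a} 1≤s 1≤ρ 2≤a l≤ m²D≤ H = *-cancelˡ-≤ 3 (begin
  -- The factor 3 pays for the successor once a is at least 2.
  3 * suc X           ≡⟨ *-suc 3 X ⟩
  3 + 3 * X           ≤⟨ +-monoʳ-≤ 3 (square-cancel-≤ {3 * X} {a + 1} 9X²≤) ⟩
  3 + (a + 1)         ≡⟨ e₀ a ⟩
  4 + a               ≤⟨ +-monoˡ-≤ a (*-monoʳ-≤ 2 2≤a) ⟩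
  2 * a + a           ≡⟨ e₁ a ⟩
  3 * a               ∎)
  where
  open ≤-Reasoning
  D = suc (suc ρ)
  X = suc m * D * s
  A = a + 1
  e₀ : ∀ a → 3 + (a + 1) ≡ 4 + a
  e₀ = solve-∀
  e₁ : ∀ a → 2 * a + a ≡ 3 * a
  e₁ = solve-∀
  D≤3ρ : D ≤ 3 * ρ
  D≤3ρ = ≤-trans (≤-reflexive (+-comm 2 ρ)) (+-monoʳ-≤ ρ (*-monoʳ-≤ 2 1≤ρ))
  s²D≤ : 128 * (s * s * D) ≤ 3 * A
  s²D≤ = *-cancelˡ-≤ 8 (begin
    8 * (128 * (s * s * D))         ≤⟨ *-monoʳ-≤ 8 (*-monoʳ-≤ 128 (*-monoʳ-≤ (s * s) D≤3ρ)) ⟩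
    8 * (128 * (s * s * (3 * ρ)))   ≡⟨ e₂ s ρ ⟩
    3 * (1024 * (s * s * ρ))        ≤⟨ *-monoʳ-≤ 3 (≤-trans H (*-monoʳ-≤ 4 (+-monoˡ-≤ 1 l≤))) ⟩
    3 * (4 * (2 * a + 1 + 1))       ≡⟨ e₃ a ⟩
    8 * (3 * (a + 1))               ∎)
    where
    e₂ : ∀ s ρ → 8 * (128 * (s * s * (3 * ρ))) ≡ 3 * (1024 * (s * s * ρ))
    e₂ = solve-∀
    e₃ : ∀ a → 3 * (4 * (2 * a + 1 + 1)) ≡ 8 * (3 * (a + 1))
    e₃ = solve-∀
  D≤ : 128 * D ≤ 3 * A
  D≤ = ≤-trans (*-monoʳ-≤ 128 (≤-trans (≤-reflexive (sym (*-identityˡ D)))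
         (*-monoˡ-≤ D (*-mono-≤ 1≤s 1≤s)))) s²D≤
  2m≤1+m² : ∀ m → 2 * m ≤ 1 + m * m
  2m≤1+m² zero = z≤n
  2m≤1+m² (suc k) = ≤-trans (m≤m+n (2 * suc k) (k * k)) (≤-reflexive (e k))
    where
    e : ∀ k → 2 * suc k + k * k ≡ 1 + suc k * suc k
    e = solve-∀
  m+1²D≤ : 128 * (suc m * suc m * D) ≤ 518 * A
  m+1²D≤ = begin
    128 * (suc m * suc m * D)                   ≡⟨ e₂ m D ⟩
    128 * ((2 * m + (1 + m * m)) * D)           ≤⟨ *-monoʳ-≤ 128 (*-monoˡ-≤ D (+-monoˡ-≤ (1 + m * m) (2m≤1+m² m))) ⟩
    128 * ((1 + m * m + (1 + m * m)) * D)       ≡⟨ e₃ m D ⟩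
    256 * (m * m * D) + 2 * (128 * D)           ≤⟨ +-mono-≤ (*-monoʳ-≤ 256 m²D≤) (*-monoʳ-≤ 2 D≤) ⟩
    256 * (2 * A) + 2 * (3 * A)                 ≡⟨ e₄ A ⟩
    518 * A                                     ∎
    where
    e₂ : ∀ m D → 128 * (suc m * suc m * D) ≡ 128 * ((2 * m + (1 + m * m)) * D)
    e₂ = solve-∀
    e₃ : ∀ m D → 128 * ((1 + m * m + (1 + m * m)) * D) ≡ 256 * (m * m * D) + 2 * (128 * D)
    e₃ = solve-∀
    e₄ : ∀ A → 256 * (2 * A) + 2 * (3 * A) ≡ 518 * A
    e₄ = solve-∀
  9X²≤ : 3 * X * (3 * X) ≤ A * A
  9X²≤ = *-cancelˡ-≤ (128 * 128) (begin
    128 * 128 * (3 * X * (3 * X))                             ≡⟨ e₂ 128 s m D ⟩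
    9 * (128 * (s * s * D) * (128 * (suc m * suc m * D)))     ≤⟨ *-monoʳ-≤ 9 (*-mono-≤ s²D≤ m+1²D≤) ⟩
    9 * (3 * A * (518 * A))                                   ≡⟨ e₃ 518 A ⟩
    -- The choice of 128 leaves room here: 128 · 128 = 27 · 518 + 2398.
    27 * 518 * (A * A)                                        ≤⟨ *-monoˡ-≤ (A * A) (m≤m+n (27 * 518) 2398) ⟩
    128 * 128 * (A * A)                                       ∎)
    where
    e₂ : ∀ k s m D → k * k * (3 * (suc m * D * s) * (3 * (suc m * D * s))) ≡
                     9 * (k * (s * s * D) * (k * (suc m * suc m * D)))
    e₂ = solve-∀
    e₃ : ∀ k A → 9 * (3 * A * (k * A)) ≡ 27 * k * (A * A)
    e₃ = solve-∀

-- From the local estimates to a bound with a rational target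

module _ {n : ℕ} (G : Graph n) where
  open Counting G

  -- With a the integer part of log I, a bound 2^e for 1 + |p| suffices as soon as e · s + 1 is at
  -- most a. Under either alternative such an e comes from I < 2^(a+1): a larger p would have too
  -- many independent sets.
  few-small-sets : ∀ {r s l b ρ a p} → NoClique r p → 1 ≤ s → 4 ≤ l → 1 ≤ b → l < 2 ^ suc b →
    1 ≤ ρ → r ≤ 2 ^ suc ρ → l ≤ 2 * a + 1 → 2 ^ a ≤ I p → I p < 2 ^ suc a →
    32 * (s * (r * b)) ≤ l + 1 ⊎ 1024 * (s * s * ρ) ≤ 4 * (l + 1) →
    2 * suc ∣ p ∣ᵖ ^ s ≤ I p
  few-small-sets {r} {s} {l} {b} {ρ} {a} {p} free 1≤s 4≤l 1≤b l< 1≤ρ r≤ l≤ 2^a≤I I<2^a+1 H = go H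
    where
    open ≤-Reasoning
    half : ∀ a → 4 ≤ 2 * a + 1 → 2 ≤ a
    half 0 (s≤s ())
    half 1 (s≤s (s≤s (s≤s ())))
    half (suc (suc _)) _ = s≤s (s≤s z≤n)
    2≤a : 2 ≤ a
    2≤a = half a (≤-trans 4≤l l≤)
    conclude : ∀ {e} → suc ∣ p ∣ᵖ ≤ 2 ^ e → suc (e * s) ≤ a → 2 * suc ∣ p ∣ᵖ ^ s ≤ I p
    conclude {e} p≤ e≤ = begin
      2 * suc ∣ p ∣ᵖ ^ s    ≤⟨ *-monoʳ-≤ 2 (^-monoˡ-≤ s p≤) ⟩
      2 * (2 ^ e) ^ s       ≡⟨ cong (2 *_) (^-*-assoc 2 e s) ⟩
      2 ^ suc (e * s)       ≤⟨ ^-monoʳ-≤ 2 e≤ ⟩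
      2 ^ a                 ≤⟨ 2^a≤I ⟩
      I p                   ∎
    go : 32 * (s * (r * b)) ≤ l + 1 ⊎ 1024 * (s * s * ρ) ≤ 4 * (l + 1) → 2 * suc ∣ p ∣ᵖ ^ s ≤ I p
    go (inj₁ H₁) = conclude {(b + 2 + q) * r} p≤
      (≤-trans (≤-reflexive (cong suc (*-assoc (b + 2 + q) r s)))
        (ramsey-exponent {r} {s} {l} {b} {a} {q} 1≤b 2≤a l≤ 1≤l (m/n*n≤m (a + 2) l) H₁))
      where
      1≤l = ≤-trans (s≤s z≤n) 4≤l
      instance
        l≢0 : NonZero l
        l≢0 = >-nonZero 1≤l
      q = (a + 2) / l
      -- The logarithm of a + 2 < (q + 1) l is estimated factor by factor, with q + 1 for the
      -- quotient and b + 1 for l.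
      a+2≤ : suc (suc a) ≤ 2 ^ (b + 2 + q)
      a+2≤ = begin
        suc (suc a)               ≡⟨ +-comm 2 a ⟩
        a + 2                     ≤⟨ <⇒≤ (m<[1+m/n]*n (a + 2) l) ⟩
        suc q * l                 ≤⟨ *-mono-≤ (<⇒≤ (n<2^n (suc q))) (<⇒≤ l<) ⟩
        2 ^ suc q * 2 ^ suc b     ≡⟨ ^-distribˡ-+-* 2 (suc q) (suc b) ⟨
        2 ^ (suc q + suc b)       ≡⟨ cong (2 ^_) (e q b) ⟩
        2 ^ (b + 2 + q)           ∎
        where
        e : ∀ q b → suc q + suc b ≡ b + 2 + q
        e = solve-∀
      p≤ : suc ∣ p ∣ᵖ ≤ 2 ^ ((b + 2 + q) * r)
      p≤ with suc (suc a) ^ r ≤? suc ∣ p ∣ᵖ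
      ... | yes large = contradiction (ramsey r (suc a) p free large) (<⇒≱ I<2^a+1)
      ... | no small = begin
        suc ∣ p ∣ᵖ                  ≤⟨ <⇒≤ (≰⇒> small) ⟩
        suc (suc a) ^ r             ≤⟨ ^-monoˡ-≤ r a+2≤ ⟩
        (2 ^ (b + 2 + q)) ^ r       ≡⟨ ^-*-assoc 2 (b + 2 + q) r ⟩
        2 ^ ((b + 2 + q) * r)       ∎
    go (inj₂ H₂) with ∣ p ∣ᵖ ≤? 0
    ... | yes p≤0 = conclude {0} (s≤s p≤0) (≤-trans (n≤1+n 1) 2≤a)
    ... | no p≰0 with floor-log ∣ p ∣ᵖ (≰⇒> p≰0)
    ... | e , 2^e≤ , <2^e+1 = conclude {suc m * D} p≤
        (growth-exponent {s} {m} {l} {ρ} {a} 1≤s 1≤ρ 2≤a l≤ (<⇒≤ (2^-cancel-< m²D<)) H₂)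
      where
      D = suc (suc ρ)
      -- Since `quadratic-growth` speaks of multiples of D only, e is rounded down to m D to apply
      -- it and up to (m + 1) D to bound |p|.
      m = e / D
      p≤ : suc ∣ p ∣ᵖ ≤ 2 ^ (suc m * D)
      p≤ = ≤-trans <2^e+1 (^-monoʳ-≤ 2 (m<[1+m/n]*n e D))
      m²D< : 2 ^ (m * m * D) < 2 ^ (2 * (a + 1))
      m²D< = begin-strict
        2 ^ (m * m * D)               ≤⟨ quadratic-growth r (suc ρ) p m free r≤ (s≤s z≤n)
                                           (≤-trans (^-monoʳ-≤ 2 (m/n*n≤m e D)) 2^e≤) ⟩
        I p * I p                     <⟨ *-mono-< I<2^a+1 I<2^a+1 ⟩
        2 ^ suc a * 2 ^ suc a         ≡⟨ ^-distribˡ-+-* 2 (suc a) (suc a) ⟨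
        2 ^ (suc a + suc a)           ≡⟨ cong (2 ^_) (e′ a) ⟩
        2 ^ (2 * (a + 1))             ∎
        where
        e′ : ∀ a → suc a + suc a ≡ 2 * (a + 1)
        e′ = solve-∀

  -- The integer form of the threshold √d for I is l ≤ 2a + 1. Above it the neighbours of v alone
  -- supply the average. Below it 2^(a+1) squared is at most 2^l, and the weight d suffices because
  -- s is at most l + 1.
  local-bound : ∀ {r d s l b ρ p} → NoClique r p → 1 ≤ s → 1 ≤ r → 4 ≤ l → 1 ≤ b → 2 ^ l ≤ d →
    l < 2 ^ suc b → 1 ≤ ρ → r ≤ 2 ^ suc ρ →
    32 * (s * (r * b)) ≤ l + 1 ⊎ 1024 * (s * s * ρ) ≤ 4 * (l + 1) →
    s * suc (I p) ≤ 4 * (d + W ones 0 p)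
  local-bound {r} {d} {s} {l} {b} {ρ} {p} free 1≤s 1≤r 4≤l 1≤b 2^l≤d l< 1≤ρ r≤ H
    with floor-log (I p) (I-positive p)
  ... | a , 2^a≤I , I<2^a+1 with l ≤? 2 * a + 1
  ... | yes l≤ = begin
    s * suc (I p)             ≤⟨ *-monoʳ-≤ s (+-monoˡ-≤ (I p) (I-positive p)) ⟩
    s * (I p + I p)           ≡⟨ e s (I p) ⟩
    2 * (s * I p)             ≤⟨ *-monoʳ-≤ 2 (average-size s p (few-small-sets {r} {s} {l} {b} {ρ} {a} {p}
                                   free 1≤s 4≤l 1≤b l< 1≤ρ r≤ l≤ 2^a≤I I<2^a+1 H)) ⟩
    2 * (2 * W ones 0 p)      ≡⟨ *-assoc 2 2 (W ones 0 p) ⟨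
    4 * W ones 0 p            ≤⟨ *-monoʳ-≤ 4 (m≤n+m (W ones 0 p) d) ⟩
    4 * (d + W ones 0 p)      ∎
    where
    open ≤-Reasoning
    e : ∀ s i → s * (i + i) ≡ 2 * (s * i)
    e = solve-∀
  ... | no l≰ = begin
    s * suc (I p)             ≤⟨ *-monoʳ-≤ s I<2^a+1 ⟩
    -- Squares are compared because 2^(l/2) need not be an integer.
    s * 2 ^ suc a             ≤⟨ square-cancel-≤ {s * 2 ^ suc a} {4 * 2 ^ l} squares ⟩
    4 * 2 ^ l                 ≤⟨ *-monoʳ-≤ 4 (≤-trans 2^l≤d (m≤m+n d _)) ⟩
    4 * (d + W ones 0 p)      ∎
    where
    open ≤-Reasoning
    s≤ : 32 * (s * (r * b)) ≤ l + 1 ⊎ 1024 * (s * s * ρ) ≤ 4 * (l + 1) → s ≤ suc l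
    s≤ (inj₁ H₁) = begin
      s                       ≡⟨ *-identityʳ s ⟨
      s * (1 * 1)             ≤⟨ *-monoʳ-≤ s (*-mono-≤ 1≤r 1≤b) ⟩
      s * (r * b)             ≤⟨ m≤n*m (s * (r * b)) 32 ⟩
      32 * (s * (r * b))      ≤⟨ H₁ ⟩
      l + 1                   ≡⟨ +-comm l 1 ⟩
      suc l                   ∎
    s≤ (inj₂ H₂) = *-cancelˡ-≤ 4 (begin
      4 * s                     ≤⟨ *-mono-≤ (m≤n+m 4 1020) (≤-reflexive (sym (trans (*-identityʳ _) (*-identityʳ s)))) ⟩
      1024 * (s * 1 * 1)        ≤⟨ *-monoʳ-≤ 1024 (*-mono-≤ (*-monoʳ-≤ s 1≤s) 1≤ρ) ⟩
      1024 * (s * s * ρ)        ≤⟨ H₂ ⟩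
      4 * (l + 1)               ≡⟨ cong (4 *_) (+-comm l 1) ⟩
      4 * suc l                 ∎)
    squares : s * 2 ^ suc a * (s * 2 ^ suc a) ≤ 4 * 2 ^ l * (4 * 2 ^ l)
    squares = begin
      s * 2 ^ suc a * (s * 2 ^ suc a)         ≡⟨ e₁ s (2 ^ suc a) ⟩
      s * s * (2 ^ suc a * 2 ^ suc a)         ≡⟨ cong (s * s *_) (^-distribˡ-+-* 2 (suc a) (suc a)) ⟨
      s * s * 2 ^ (suc a + suc a)             ≤⟨ *-mono-≤ (*-mono-≤ (s≤ H) (s≤ H))
                                                   (^-monoʳ-≤ 2 (≤-trans (≤-reflexive (e₂ a)) (≰⇒> l≰))) ⟩
      suc l * suc l * 2 ^ l                   ≤⟨ *-monoˡ-≤ (2 ^ l) (suc-square≤16*2^ l) ⟩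
      16 * 2 ^ l * 2 ^ l                      ≡⟨ e₃ (2 ^ l) ⟩
      4 * 2 ^ l * (4 * 2 ^ l)                 ∎
      where
      e₁ : ∀ s x → s * x * (s * x) ≡ s * s * (x * x)
      e₁ = solve-∀
      e₂ : ∀ a → suc a + suc a ≡ suc (2 * a + 1)
      e₂ = solve-∀
      e₃ : ∀ x → 16 * x * x ≡ 4 * x * (4 * x)
      e₃ = solve-∀

  -- The target 1 is available in every neighbourhood; it takes over when the real target rounds
  -- down to 0.
  greedy-bound : ∀ {d} p → 1 ≤ d → 1 * suc (I p) ≤ 4 * (d + W ones 0 p)
  greedy-bound {d} p 1≤d = begin
    1 * suc (I p)                         ≡⟨ *-identityˡ (suc (I p)) ⟩
    suc (I p)                             ≤⟨ s≤s (weigh-ones p V) ⟩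
    suc (W ones 0 p + 1)                  ≤⟨ m≤m+n _ (2 + 3 * W ones 0 p) ⟩
    suc (W ones 0 p + 1) + (2 + 3 * W ones 0 p)   ≡⟨ e (W ones 0 p) ⟩
    4 * (1 + W ones 0 p)                  ≤⟨ *-monoʳ-≤ 4 (+-monoˡ-≤ (W ones 0 p) 1≤d) ⟩
    4 * (d + W ones 0 p)                  ∎
    where
    open ≤-Reasoning
    e : ∀ w → suc (w + 1) + (2 + 3 * w) ≡ 4 * (1 + w)
    e = solve-∀

  -- The conclusion has s + 1 where the hypothesis has s, so that a fractional target can be rounded
  -- down in the one and up in the other. For positive s this doubles the factor 8 of `shearer`.
  integral-bound : ∀ {r d l b ρ} s → CliqueFree r G → MaxDegreeAtMost d G → 1 ≤ r → 4 ≤ l → 1 ≤ b →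
    2 ^ l ≤ d → l < 2 ^ suc b → 1 ≤ ρ → r ≤ 2 ^ suc ρ →
    32 * (s * (r * b)) ≤ l + 1 ⊎ 1024 * (s * s * ρ) ≤ 4 * (l + 1) →
    n * suc s ≤ 16 * d * α G
  integral-bound {d = d} {l} zero free deg 1≤r 4≤l 1≤b 2^l≤d l< 1≤ρ r≤ H = ≤-trans
    (shearer 1 d deg λ v p _ → greedy-bound p (≤-trans (m^n>0 2 l) 2^l≤d))
    (*-monoˡ-≤ (α G) (*-monoˡ-≤ d (m≤n+m 8 8)))
  integral-bound {r} {d} {l} {b} {ρ} (suc s) free deg 1≤r 4≤l 1≤b 2^l≤d l< 1≤ρ r≤ H = begin
    n * suc (suc s)           ≤⟨ *-monoʳ-≤ n (s≤s (m≤n+m (suc s) s)) ⟩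
    n * (suc s + suc s)       ≡⟨ *-distribˡ-+ n (suc s) (suc s) ⟩
    n * suc s + n * suc s     ≤⟨ +-mono-≤ half half ⟩
    8 * d * α G + 8 * d * α G ≡⟨ e d (α G) ⟩
    16 * d * α G              ∎
    where
    open ≤-Reasoning
    half : n * suc s ≤ 8 * d * α G
    half = shearer (suc s) d deg λ v p _ →
      local-bound {r} {d} {suc s} {l} {b} {ρ} {p} (NoClique-graph free p) (s≤s z≤n) 1≤r 4≤l 1≤b 2^l≤d l< 1≤ρ r≤ H
    e : ∀ d a → 8 * d * a + 8 * d * a ≡ 16 * d * a
    e = solve-∀

  -- The target is x / y and s is the integer part of x / (32 y), which supplies the 32 and the 1024
  -- = 32 · 32 demanded above; together with the 16 of `integral-bound` this makes 512. The 4 in the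
  -- second alternative is the allowance for the loss in `k≤4t`.
  fractional-bound : ∀ {r d l b ρ} x y → CliqueFree r G → MaxDegreeAtMost d G → 1 ≤ r → 4 ≤ l → 1 ≤ b →
    2 ^ l ≤ d → l < 2 ^ suc b → 1 ≤ ρ → r ≤ 2 ^ suc ρ → 1 ≤ y →
    x * (r * b) ≤ y * (l + 1) ⊎ x * x * ρ ≤ 4 * (y * y * (l + 1)) →
    n * x ≤ 512 * (y * (d * α G))
  fractional-bound {r} {d} {l} {b} {ρ} x y free deg 1≤r 4≤l 1≤b 2^l≤d l< 1≤ρ r≤ 1≤y H = begin
    n * x                             ≤⟨ *-monoʳ-≤ n (<⇒≤ (m<[1+m/n]*n x (32 * y))) ⟩
    n * (suc s * (32 * y))            ≡⟨ e₁ n (suc s) y ⟩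
    32 * y * (n * suc s)              ≤⟨ *-monoʳ-≤ (32 * y) (integral-bound {r} {d} {l} {b} {ρ} s free deg 1≤r 4≤l 1≤b 2^l≤d l< 1≤ρ r≤ (scale H)) ⟩
    32 * y * (16 * d * α G)           ≡⟨ e₂ y d (α G) ⟩
    512 * (y * (d * α G))             ∎
    where
    open ≤-Reasoning
    instance
      y≢0 : NonZero y
      y≢0 = >-nonZero 1≤y
      32y≢0 : NonZero (32 * y)
      32y≢0 = m*n≢0 32 y
      yy≢0 : NonZero (y * y)
      yy≢0 = m*n≢0 y y
    s = x / (32 * y)
    s≤ : s * (32 * y) ≤ x
    s≤ = m/n*n≤m x (32 * y)
    e₁ : ∀ n s y → n * (s * (32 * y)) ≡ 32 * y * (n * s)
    e₁ = solve-∀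
    e₂ : ∀ y d a → 32 * y * (16 * d * a) ≡ 512 * (y * (d * a))
    e₂ = solve-∀
    scale : x * (r * b) ≤ y * (l + 1) ⊎ x * x * ρ ≤ 4 * (y * y * (l + 1)) →
      32 * (s * (r * b)) ≤ l + 1 ⊎ 1024 * (s * s * ρ) ≤ 4 * (l + 1)
    scale (inj₁ H₁) = inj₁ (*-cancelˡ-≤ y (begin
      y * (32 * (s * (r * b)))        ≡⟨ e y s (r * b) ⟩
      s * (32 * y) * (r * b)          ≤⟨ *-monoˡ-≤ (r * b) s≤ ⟩
      x * (r * b)                     ≤⟨ H₁ ⟩
      y * (l + 1)                     ∎))
      where
      e : ∀ y s z → y * (32 * (s * z)) ≡ s * (32 * y) * z
      e = solve-∀
    scale (inj₂ H₂) = inj₂ (*-cancelˡ-≤ (y * y) (begin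
      y * y * (1024 * (s * s * ρ))            ≡⟨ e y s ρ ⟩
      s * (32 * y) * (s * (32 * y)) * ρ       ≤⟨ *-monoˡ-≤ ρ (*-mono-≤ s≤ s≤) ⟩
      x * x * ρ                               ≤⟨ H₂ ⟩
      4 * (y * y * (l + 1))                   ≡⟨ e′ (y * y) (l + 1) ⟩
      y * y * (4 * (l + 1))                   ∎))
      where
      e : ∀ y s ρ → y * y * (1024 * (s * s * ρ)) ≡ s * (32 * y) * (s * (32 * y)) * ρ
      e = solve-∀
      e′ : ∀ z w → 4 * (z * w) ≡ z * (4 * w)
      e′ = solve-∀

-- Rationals and cuts

module Exp = RawSemiring ℚ.+-*-rawSemiring

-- Unfolding ι would make the type checker normalise fractions.
opaque
  ι : ℕ → ℚ
  ι a = ℤ.+ a ℚ./ 1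

  ι-/1 : ∀ a → ι a ≡ ℤ.+ a ℚ./ 1
  ι-/1 a = refl

coprime-1 : ∀ a → Coprime a 1
coprime-1 a = coprime-sym (1-coprimeTo a)

ι-mkℚ : ∀ a → ι a ≡ mkℚ (ℤ.+ a) 0 (coprime-1 a)
ι-mkℚ a = trans (ι-/1 a) (ℚ.normalize-coprime (coprime-1 a))

ι-* : ∀ a b → ι (a * b) ≡ ι a ℚ.* ι b
ι-* a b rewrite ι-mkℚ a | ι-mkℚ b = trans (ι-/1 (a * b)) (cong (ℚ._/ 1) (ℤ.pos-* a b))

ι-mono-≤ : ∀ {a b} → a ≤ b → ι a ℚ.≤ ι b
ι-mono-≤ {a} {b} a≤b rewrite ι-mkℚ a | ι-mkℚ b = ℚ.*≤* (ℤ.*-monoʳ-≤-nonNeg (ℤ.+ 1) (ℤ.+≤+ a≤b))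

ι-mono-< : ∀ {a b} → a < b → ι a ℚ.< ι b
ι-mono-< {a} {b} a<b rewrite ι-mkℚ a | ι-mkℚ b = ℚ.*<* (ℤ.*-monoʳ-<-pos (ℤ.+ 1) (ℤ.+<+ a<b))

ι-cancel-≤ : ∀ {a b} → ι a ℚ.≤ ι b → a ≤ b
ι-cancel-≤ {a} {b} le with a ≤? b
... | yes a≤b = a≤b
... | no a≰b = contradiction (ℚ.<-≤-trans (ι-mono-< (≰⇒> a≰b)) le) (ℚ.<-irrefl refl)

ι-cancel-< : ∀ {a b} → ι a ℚ.< ι b → a < b
ι-cancel-< {a} {b} lt with a <? b
... | yes a<b = a<b
... | no a≮b = contradiction (ℚ.<-≤-trans lt (ι-mono-≤ (≮⇒≥ a≮b))) (ℚ.<-irrefl refl)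

0≤ι : ∀ a → 0ℚ ℚ.≤ ι a
0≤ι a = subst (ℚ._≤ ι a) (ι-/1 0) (ι-mono-≤ {0} {a} z≤n)

0<ι : ∀ {a} → 1 ≤ a → 0ℚ ℚ.< ι a
0<ι {a} 1≤a = subst (ℚ._< ι a) (ι-/1 0) (ι-mono-< {0} 1≤a)

0<1 : 0ℚ ℚ.< 1ℚ
0<1 = ℚ.positive⁻¹ 1ℚ

fromℕ-L : ∀ {m q} → L (fromℕ m) q → q ℚ.< ι m
fromℕ-L {m} {q} = subst (q ℚ.<_) (sym (ι-/1 m))

fromℕ-L⁺ : ∀ {m q} → q ℚ.< ι m → L (fromℕ m) q
fromℕ-L⁺ {m} {q} = subst (q ℚ.<_) (ι-/1 m)

fromℕ-U : ∀ {m q} → U (fromℕ m) q → ι m ℚ.< q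
fromℕ-U {m} {q} = subst (ℚ._< q) (sym (ι-/1 m))

*-monoˡ : ∀ {x y z} → 0ℚ ℚ.≤ z → x ℚ.≤ y → x ℚ.* z ℚ.≤ y ℚ.* z
*-monoˡ {z = z} 0≤z = ℚ.*-monoʳ-≤-nonNeg z {{ℚ.nonNegative 0≤z}}

*-monoʳ : ∀ {x y z} → 0ℚ ℚ.≤ z → x ℚ.≤ y → z ℚ.* x ℚ.≤ z ℚ.* y
*-monoʳ {z = z} 0≤z = ℚ.*-monoˡ-≤-nonNeg z {{ℚ.nonNegative 0≤z}}

*-mono : ∀ {x y z w} → 0ℚ ℚ.≤ x → 0ℚ ℚ.≤ w → x ℚ.≤ y → z ℚ.≤ w → x ℚ.* z ℚ.≤ y ℚ.* w
*-mono 0≤x 0≤w x≤y z≤w = ℚ.≤-trans (*-monoʳ 0≤x z≤w) (*-monoˡ 0≤w x≤y)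

*-nonneg : ∀ {x y} → 0ℚ ℚ.≤ x → 0ℚ ℚ.≤ y → 0ℚ ℚ.≤ x ℚ.* y
*-nonneg {x} {y} 0≤x 0≤y = subst (ℚ._≤ x ℚ.* y) (ℚ.*-zeroˡ y) (*-monoˡ 0≤y 0≤x)

*-pos : ∀ {x y} → 0ℚ ℚ.< x → 0ℚ ℚ.< y → 0ℚ ℚ.< x ℚ.* y
*-pos {x} {y} 0<x 0<y = subst (ℚ._< x ℚ.* y) (ℚ.*-zeroˡ y)
  (ℚ.*-monoˡ-<-pos y {{ℚ.positive 0<y}} 0<x)

pos-factorˡ : ∀ {x y} → 0ℚ ℚ.< x ℚ.* y → 0ℚ ℚ.≤ y → 0ℚ ℚ.< x
pos-factorˡ {x} {y} 0<xy 0≤y with 0ℚ ℚ.<? x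
... | yes 0<x = 0<x
... | no 0≮x = contradiction
  (ℚ.<-≤-trans 0<xy (subst (x ℚ.* y ℚ.≤_) (ℚ.*-zeroˡ y) (*-monoˡ 0≤y (ℚ.≮⇒≥ 0≮x))))
  (ℚ.<-irrefl refl)

pos-factorʳ : ∀ {x y} → 0ℚ ℚ.< x ℚ.* y → 0ℚ ℚ.≤ x → 0ℚ ℚ.< y
pos-factorʳ {x} {y} 0<xy = pos-factorˡ (subst (0ℚ ℚ.<_) (ℚ.*-comm x y) 0<xy)

^-nonneg : ∀ {x} k → 0ℚ ℚ.≤ x → 0ℚ ℚ.≤ x Exp.^ k
^-nonneg zero _ = ℚ.<⇒≤ 0<1
^-nonneg (suc k) 0≤x = *-nonneg 0≤x (^-nonneg k 0≤x)

^-mono : ∀ {x y} k → 0ℚ ℚ.≤ x → x ℚ.≤ y → x Exp.^ k ℚ.≤ y Exp.^ k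
^-mono zero _ _ = ℚ.≤-refl
^-mono (suc k) 0≤x x≤y = *-mono 0≤x (^-nonneg k (ℚ.≤-trans 0≤x x≤y)) x≤y (^-mono k 0≤x x≤y)

½^≤1 : ∀ k → ½ Exp.^ k ℚ.≤ 1ℚ
½^≤1 zero = ℚ.≤-refl
½^≤1 (suc k) = *-mono {½} {1ℚ} (ℚ.≤ᵇ⇒≤ _) (ℚ.<⇒≤ 0<1) (ℚ.≤ᵇ⇒≤ _) (½^≤1 k)

-- Powers of two and logarithms of cuts

ι-^ : ∀ a k → ι (a ^ k) ≡ ι a Exp.^ k
ι-^ a zero = ι-/1 1
ι-^ a (suc k) = trans (ι-* a (a ^ k)) (cong (ι a ℚ.*_) (ι-^ a k))

ι-2^ : ∀ k → ι (2 ^ k) ≡ 2^ (ℤ.+ k)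
ι-2^ k = trans (ι-^ 2 k) (cong (Exp._^ k) (ι-/1 2))

ι-2^-^ : ∀ k q → ι (2 ^ (k * q)) ≡ ι (2 ^ k) Exp.^ q
ι-2^-^ k q = trans (cong ι (sym (^-*-assoc 2 k q))) (ι-^ (2 ^ k) q)

-- Raising to the denominator of e turns the claim into a comparison of powers of 2 in ℕ. A negative
-- e is impossible, since then 2^e is at most 1 while 2^k is at least 1.
<2^-lower : ∀ k {t e} → ι (2 ^ k) ℚ.≤ t → t <2^ e → ι k ℚ.< e
<2^-lower k {t} 2^k≤t (inj₁ t≤0) =
  contradiction (ℚ.<-≤-trans (0<ι (m^n>0 2 k)) (ℚ.≤-trans 2^k≤t t≤0)) (ℚ.<-irrefl refl)
<2^-lower k {t} {mkℚ (ℤ.+ p) q-1 _} 2^k≤t (inj₂ lt) = below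
  where
  q = suc q-1
  kq<p : k * q < p
  kq<p = 2^-cancel-< (ι-cancel-< (ℚ.≤-<-trans
    (ℚ.≤-trans (ℚ.≤-reflexive (ι-2^-^ k q)) (^-mono q (0≤ι (2 ^ k)) 2^k≤t))
    (subst (t Exp.^ q ℚ.<_) (sym (ι-2^ p)) lt)))
  below : ι k ℚ.< _
  below rewrite ι-mkℚ k = ℚ.*<* (subst₂ ℤ._<_ (ℤ.pos-* k q) (sym (ℤ.*-identityʳ (ℤ.+ p))) (ℤ.+<+ kq<p))
<2^-lower k {t} {mkℚ -[1+ p ] q-1 _} 2^k≤t (inj₂ lt) = contradiction
  (ℚ.≤-<-trans (ℚ.≤-trans (ℚ.≤-trans (ℚ.≤-reflexive (sym (ι-/1 1))) (ι-mono-≤ (m^n>0 2 (k * suc q-1))))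
    (ℚ.≤-trans (ℚ.≤-reflexive (ι-2^-^ k (suc q-1))) (^-mono (suc q-1) (0≤ι (2 ^ k)) 2^k≤t)))
    (ℚ.<-≤-trans lt (½^≤1 (suc p))))
  (ℚ.<-irrefl refl)

>2^-upper : ∀ k {t a} → t ℚ.≤ ι (2 ^ k) → t >2^ a → a ℚ.< ι k
>2^-upper k {t} {mkℚ (ℤ.+ p) q-1 _} t≤2^k (0<t , lt) = above
  where
  q = suc q-1
  p<kq : p < k * q
  p<kq = 2^-cancel-< (ι-cancel-< (ℚ.<-≤-trans
    (subst (ℚ._< t Exp.^ q) (sym (ι-2^ p)) lt)
    (ℚ.≤-trans (^-mono q (ℚ.<⇒≤ 0<t) t≤2^k) (ℚ.≤-reflexive (sym (ι-2^-^ k q))))))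
  above : _ ℚ.< ι k
  above rewrite ι-mkℚ k = ℚ.*<* (subst₂ ℤ._<_ (sym (ℤ.*-identityʳ (ℤ.+ p))) (ℤ.pos-* k q) (ℤ.+<+ p<kq))
>2^-upper k {t} {mkℚ -[1+ p ] _ _} _ _ = ℚ.<-≤-trans (ℚ.negative⁻¹ _) (0≤ι k)

log-lower : ∀ k {x e} → (∀ {t} → U x t → ι (2 ^ k) ℚ.≤ t) → U (log x) e → ι k ℚ.< e
log-lower k above (t , xt , t<) = <2^-lower k (above xt) t<

log-upper : ∀ k {x a} → (∀ {t} → L x t → t ℚ.≤ ι (2 ^ k)) → L (log x) a → a ℚ.< ι k
log-upper k below (t , xt , t>) = >2^-upper k (below xt) t>

*ᵣ-L : ∀ {x y q} → (∀ {b} → U x b → 0ℚ ℚ.≤ b) → (∀ {e} → U y e → 0ℚ ℚ.≤ e) → 0ℚ ℚ.≤ q →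
  L (x *ᵣ y) q → ∃₂ λ a c → L x a × L y c × 0ℚ ℚ.< a × 0ℚ ℚ.< c × q ℚ.< a ℚ.* c
-- The two mixed corners of the box exceed q ≥ 0, and with b and e nonnegative this forces both
-- lower ends a and c to be positive.
*ᵣ-L x≥0 y≥0 0≤q (a , b , c , e , (xa , xb , yc , ye) , q<ac , q<ae , q<bc , _) =
  a , c , xa , yc , pos-factorˡ (ℚ.≤-<-trans 0≤q q<ae) (y≥0 ye) ,
  pos-factorʳ (ℚ.≤-<-trans 0≤q q<bc) (x≥0 xb) , q<ac

*ᵣ-U : ∀ {x y X Y t} → 0ℚ ℚ.≤ X → 0ℚ ℚ.≤ Y → (∀ {b} → U x b → X ℚ.≤ b) → (∀ {e} → U y e → Y ℚ.≤ e) →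
  U (x *ᵣ y) t → X ℚ.* Y ℚ.< t
*ᵣ-U 0≤X 0≤Y X≤ Y≤ (a , b , c , e , (xa , xb , yc , ye) , _ , _ , _ , be<t) =
  ℚ.≤-<-trans (*-mono 0≤X (ℚ.≤-trans 0≤Y (Y≤ ye)) (X≤ xb) (Y≤ ye)) be<t

⁻¹ᵣ-U : ∀ {y e} → U (y ⁻¹ᵣ) e → 0ℚ ℚ.< e
⁻¹ᵣ-U (t , _ , 0<t , 1<et) = pos-factorˡ (ℚ.<-trans 0<1 1<et) (ℚ.<⇒≤ 0<t)

/ᵣ-L : ∀ {x y q} → (∀ {b} → U x b → 0ℚ ℚ.≤ b) → (∀ {t} → U y t → 0ℚ ℚ.< t) → 0ℚ ℚ.≤ q →
  L (x /ᵣ y) q → ∃₂ λ a t → L x a × U y t × q ℚ.* t ℚ.< a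
/ᵣ-L {x} {y} {q} x≥0 y>0 0≤q q∈
  with *ᵣ-L {x} {y ⁻¹ᵣ} x≥0 (λ e∈ → ℚ.<⇒≤ (⁻¹ᵣ-U {y} e∈)) 0≤q q∈
... | a , c , xa , (t , yt , ct<1) , 0<a , _ , q<ac = a , t , xa , yt , (begin-strict
  q ℚ.* t             <⟨ ℚ.*-monoˡ-<-pos t {{ℚ.positive (y>0 yt)}} q<ac ⟩
  a ℚ.* c ℚ.* t       ≡⟨ ℚ.*-assoc a c t ⟩
  a ℚ.* (c ℚ.* t)     ≤⟨ *-monoʳ (ℚ.<⇒≤ 0<a) (ℚ.<⇒≤ ct<1) ⟩
  a ℚ.* 1ℚ            ≡⟨ ℚ.*-identityʳ a ⟩
  a                   ∎)
  where open ℚ.≤-Reasoning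

-- The constant 1/512 and the reduction to rational targets

c₀ : ℚ
c₀ = ℤ.+ 1 ℚ./ 512

fromℚ-real : ∀ {q} → 0ℚ ℚ.< q → q ℚ.< 1ℚ → IsReal (fromℚ q)
fromℚ-real {q} 0<q q<1 = record
  { L-inhabited = 0ℚ , 0<q
  ; U-inhabited = 1ℚ , q<1
  ; L-closed = ℚ.<-trans
  ; U-closed = λ p<p′ q<p → ℚ.<-trans q<p p<p′
  ; L-open = ℚ.<-dense
  ; U-open = λ q<p → let m , q<m , m<p = ℚ.<-dense q<p in m , m<p , q<m
  ; disjoint = ℚ.<-asym
  ; located = λ {p} {p′} p<p′ → located p<p′
  }
  where
  located : ∀ {p p′} → p ℚ.< p′ → p ℚ.< q ⊎ q ℚ.< p′
  located {p} p<p′ with p ℚ.<? q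
  ... | yes p<q = inj₁ p<q
  ... | no p≮q = inj₂ (ℚ.≤-<-trans (ℚ.≮⇒≥ p≮q) p<p′)

positive-c₀ : 0ℚ ℚ.< c₀
positive-c₀ = ℚ.positive⁻¹ c₀

c₀-real : IsReal (fromℚ c₀)
c₀-real = fromℚ-real positive-c₀ (ℚ.*<* (ℤ.+<+ (≤ᵇ⇒≤ 2 512 _)))

0<c₀ : 0ᵣ <ᵣ fromℚ c₀
0<c₀ = ℚ.<-dense positive-c₀

c₀*512 : c₀ ℚ.* ι 512 ≡ 1ℚ
c₀*512 = cong (c₀ ℚ.*_) (ι-/1 512)

xy∙zw≡zx∙wy : ∀ x y z w → x ℚ.* y ℚ.* (z ℚ.* w) ≡ z ℚ.* x ℚ.* (w ℚ.* y)
xy∙zw≡zx∙wy = solve 4 (λ x y z w → x :* y :* (z :* w) := z :* x :* (w :* y)) refl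
  where open +-*-Solver

xy∙z≡y∙xz : ∀ x y z → x ℚ.* y ℚ.* z ≡ y ℚ.* (x ℚ.* z)
xy∙z≡y∙xz = solve 3 (λ x y z → x :* y :* z := y :* (x :* z)) refl
  where open +-*-Solver

x∙yz≡y∙xz : ∀ x y z → x ℚ.* (y ℚ.* z) ≡ y ℚ.* (x ℚ.* z)
x∙yz≡y∙xz x y z = trans (sym (ℚ.*-assoc x y z)) (xy∙z≡y∙xz x y z)

xy∙xyz≡y∙y∙xxz : ∀ x y z → x ℚ.* y ℚ.* (x ℚ.* y ℚ.* z) ≡ y ℚ.* (y ℚ.* (x ℚ.* x ℚ.* z))
xy∙xyz≡y∙y∙xxz = solve 3 (λ x y z → x :* y :* (x :* y :* z) := y :* (y :* (x :* x :* z))) refl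
  where open +-*-Solver

x∙y∙z≡xz∙y : ∀ x y z → x ℚ.* (y ℚ.* z) ≡ x ℚ.* z ℚ.* y
x∙y∙z≡xz∙y x y z = trans (cong (x ℚ.*_) (ℚ.*-comm y z)) (sym (ℚ.*-assoc x z y))

-- With K = 1/c this says that u below c · (n / d) satisfies K d u ≤ n; the quotient is present only
-- through the rational witnesses of the cuts involved.
scale-upper : ∀ {c K d n u v w t n′} → 0ℚ ℚ.< K → c ℚ.* K ≡ 1ℚ → 0ℚ ℚ.≤ d →
  v ℚ.< c → 0ℚ ℚ.< w → u ℚ.< v ℚ.* w → d ℚ.< t → w ℚ.* t ℚ.< n′ → n′ ℚ.< n → K ℚ.* d ℚ.* u ℚ.≤ n
scale-upper {c} {K} {d} {n} {u} {v} {w} {t} 0<K cK≡1 0≤d v<c 0<w u<vw d<t wt<n′ n′<n = begin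
  K ℚ.* d ℚ.* u                 ≤⟨ *-monoʳ 0≤Kd (ℚ.<⇒≤ u<vw) ⟩
  K ℚ.* d ℚ.* (v ℚ.* w)         ≤⟨ *-monoʳ 0≤Kd (*-monoˡ (ℚ.<⇒≤ 0<w) (ℚ.<⇒≤ v<c)) ⟩
  K ℚ.* d ℚ.* (c ℚ.* w)         ≡⟨ xy∙zw≡zx∙wy K d c w ⟩
  c ℚ.* K ℚ.* (w ℚ.* d)         ≡⟨ trans (cong (ℚ._* (w ℚ.* d)) cK≡1) (ℚ.*-identityˡ (w ℚ.* d)) ⟩
  w ℚ.* d                       ≤⟨ *-monoʳ (ℚ.<⇒≤ 0<w) (ℚ.<⇒≤ d<t) ⟩
  w ℚ.* t                       ≤⟨ ℚ.<⇒≤ (ℚ.<-trans wt<n′ n′<n) ⟩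
  n                             ∎
  where
  open ℚ.≤-Reasoning
  0≤Kd : 0ℚ ℚ.≤ K ℚ.* d
  0≤Kd = *-nonneg (ℚ.<⇒≤ 0<K) 0≤d

scale-cancel : ∀ {K d n q u τ a} → 0ℚ ℚ.< K → 0ℚ ℚ.< d → 0ℚ ℚ.< τ → q ℚ.< u ℚ.* τ →
  K ℚ.* d ℚ.* u ℚ.≤ n → n ℚ.* τ ℚ.≤ K ℚ.* (d ℚ.* a) → q ℚ.< a
scale-cancel {K} {d} {n} {q} {u} {τ} {a} 0<K 0<d 0<τ q<uτ Kdu≤n nτ≤ =
  ℚ.*-cancelˡ-<-nonNeg Z {{ℚ.nonNegative (ℚ.<⇒≤ 0<Z)}} (begin-strict
    Z ℚ.* q                         <⟨ ℚ.*-monoʳ-<-pos Z {{ℚ.positive 0<Z}} q<uτ ⟩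
    Z ℚ.* (u ℚ.* τ)                 ≡⟨ ℚ.*-assoc Z u τ ⟨
    Z ℚ.* u ℚ.* τ                   ≤⟨ *-monoˡ (ℚ.<⇒≤ 0<τ) Kdu≤n ⟩
    n ℚ.* τ                         ≤⟨ nτ≤ ⟩
    K ℚ.* (d ℚ.* a)                 ≡⟨ ℚ.*-assoc K d a ⟨
    Z ℚ.* a                         ∎)
  where
  open ℚ.≤-Reasoning
  Z = K ℚ.* d
  0<Z : 0ℚ ℚ.< Z
  0<Z = *-pos 0<K 0<d

module _ {n d : ℕ} {c K : ℚ} (0<c : 0ℚ ℚ.< c) (0<K : 0ℚ ℚ.< K) (cK≡1 : c ℚ.* K ≡ 1ℚ) where
  private
    n≥0 : ∀ {b} → U (fromℕ n) b → 0ℚ ℚ.≤ b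
    n≥0 n<b = ℚ.≤-trans (0≤ι n) (ℚ.<⇒≤ (fromℕ-U n<b))

    c≥0 : ∀ {b} → U (fromℚ c) b → 0ℚ ℚ.≤ b
    c≥0 c<b = ℚ.<⇒≤ (ℚ.<-trans 0<c c<b)

    n/d≥0 : ∀ {b} → U (fromℕ n /ᵣ fromℕ d) b → 0ℚ ℚ.≤ b
    n/d≥0 b∈ = ℚ.<⇒≤ (*ᵣ-U {fromℕ n} {fromℕ d ⁻¹ᵣ} ℚ.≤-refl ℚ.≤-refl n≥0
      (λ e∈ → ℚ.<⇒≤ (⁻¹ᵣ-U {fromℕ d} e∈)) b∈)

    cn/d≥0 : ∀ {b} → U (fromℚ c *ᵣ (fromℕ n /ᵣ fromℕ d)) b → 0ℚ ℚ.≤ b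
    cn/d≥0 b∈ = ℚ.<⇒≤ (*ᵣ-U {fromℚ c} {fromℕ n /ᵣ fromℕ d} ℚ.≤-refl ℚ.≤-refl c≥0 n/d≥0 b∈)

  -- A nonnegative q below the product lies below u · τ with u below c · (n / d) and τ below M, so M
  -- has to be examined only at its positive rationals τ. A negative q is below any natural number.
  scaled-bound : ∀ {a M} → 1 ≤ d → (∀ {e} → U M e → 0ℚ ℚ.≤ e) →
    (∀ τ → 0ℚ ℚ.< τ → L M τ → ι n ℚ.* τ ℚ.≤ K ℚ.* (ι d ℚ.* ι a)) →
    fromℚ c *ᵣ (fromℕ n /ᵣ fromℕ d) *ᵣ M ≤ᵣ fromℕ a
  scaled-bound {a} {M} 1≤d M≥0 bound q q∈ = fromℕ-L⁺ {a} (below (q ℚ.<? 0ℚ))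
    where
    below : Dec (q ℚ.< 0ℚ) → q ℚ.< ι a
    below (yes q<0) = ℚ.<-≤-trans q<0 (0≤ι a)
    below (no q≮0) =
      let u , τ , u∈ , τ∈ , 0<u , 0<τ , q<uτ =
            *ᵣ-L {fromℚ c *ᵣ (fromℕ n /ᵣ fromℕ d)} {M} cn/d≥0 M≥0 (ℚ.≮⇒≥ q≮0) q∈
          v , w , v<c , w∈ , _ , 0<w , u<vw =
            *ᵣ-L {fromℚ c} {fromℕ n /ᵣ fromℕ d} c≥0 n/d≥0 (ℚ.<⇒≤ 0<u) u∈
          n′ , t , n′<n , d<t , wt<n′ =
            /ᵣ-L {fromℕ n} {fromℕ d} n≥0 (λ d<t → ℚ.≤-<-trans (0≤ι d) (fromℕ-U d<t)) (ℚ.<⇒≤ 0<w) w∈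
      in scale-cancel {K} {ι d} {ι n} {q} {u} {τ} {ι a} 0<K (0<ι 1≤d) 0<τ q<uτ
           (scale-upper {c} {K} {ι d} {ι n} {u} {v} {w} {t} {n′}
             0<K cK≡1 (0≤ι d) v<c 0<w u<vw (fromℕ-U d<t) wt<n′ (fromℕ-L n′<n))
           (bound τ 0<τ τ∈)

↧-clear : ∀ x y-1 .(c : Coprime x (suc y-1)) → mkℚ (ℤ.+ x) y-1 c ℚ.* ι (suc y-1) ≡ ι x
↧-clear x y-1 c rewrite ι-mkℚ (suc y-1) | ι-/1 x = ℚ.fromℚᵘ-cong
  {ℚᵘ.mkℚᵘ (ℤ.+ x ℤ.* ℤ.+ suc y-1) (y-1 * 1)} {ℚᵘ.mkℚᵘ (ℤ.+ x) 0}
  (ℚᵘ.*≡* (trans (ℤ.*-identityʳ _) (cong (λ k → ℤ.+ x ℤ.* ℤ.+ suc k) (sym (*-identityʳ y-1)))))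

-- The witnesses l, b and k are the integer parts of log d, log log d and log r.
record Scales (r d : ℕ) : Set where
  field
    {l b k} : ℕ
    1≤r : 1 ≤ r
    4≤l : 4 ≤ l
    1≤b : 1 ≤ b
    1≤k : 1 ≤ k
    2^l≤d : 2 ^ l ≤ d
    d<2^l+1 : d < 2 ^ suc l
    2^b≤l : 2 ^ b ≤ l
    l<2^b+1 : l < 2 ^ suc b
    2^k≤r : 2 ^ k ≤ r
    r<2^k+1 : r < 2 ^ suc k

scales : ∀ {r d} → 2 ≤ r → 16 ≤ d → Scales r d
scales {r} {d} 2≤r 16≤d
  with floor-log d (≤-trans (s≤s z≤n) 16≤d) | floor-log r (≤-trans (s≤s z≤n) 2≤r)
... | l , 2^l≤d , d<2^l+1 | k , 2^k≤r , r<2^k+1 = record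
  { l = l
  ; b = proj₁ floor-l
  ; k = k
  ; 1≤r = ≤-trans (s≤s z≤n) 2≤r
  ; 4≤l = 4≤l
  ; 1≤b = s≤s⁻¹ (2^-cancel-< {1} (≤-<-trans (≤-trans (≤ᵇ⇒≤ 2 4 _) 4≤l) (proj₂ (proj₂ floor-l))))
  ; 1≤k = s≤s⁻¹ (2^-cancel-< {1} (≤-<-trans 2≤r r<2^k+1))
  ; 2^l≤d = 2^l≤d
  ; d<2^l+1 = d<2^l+1
  ; 2^b≤l = proj₁ (proj₂ floor-l)
  ; l<2^b+1 = proj₂ (proj₂ floor-l)
  ; 2^k≤r = 2^k≤r
  ; r<2^k+1 = r<2^k+1
  }
  where
  4≤l : 4 ≤ l
  4≤l = s≤s⁻¹ (2^-cancel-< {4} (≤-<-trans 16≤d d<2^l+1))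
  floor-l = floor-log l (≤-trans (s≤s z≤n) 4≤l)

-- The two bounds for a fixed graph

module Bounds {r d n : ℕ} (2≤r : 2 ≤ r) (16≤d : 16 ≤ d) (G : Graph n)
  (deg : MaxDegreeAtMost d G) (free : CliqueFree r G) where
  open Scales (scales 2≤r 16≤d)

  log-d logr loglog-d : Cut
  log-d = log (fromℕ d)
  logr = log (fromℕ r)
  loglog-d = log log-d

  log-d-lower : ∀ {e} → U log-d e → ι l ℚ.< e
  log-d-lower = log-lower l {fromℕ d} λ d<t → ℚ.≤-trans (ι-mono-≤ 2^l≤d) (ℚ.<⇒≤ (fromℕ-U d<t))

  log-d-upper : ∀ {a} → L log-d a → a ℚ.< ι (suc l)
  log-d-upper = log-upper (suc l) {fromℕ d} λ t<d → ℚ.<⇒≤ (ℚ.<-trans (fromℕ-L t<d) (ι-mono-< d<2^l+1))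

  loglog-d-lower : ∀ {e} → U loglog-d e → ι b ℚ.< e
  loglog-d-lower = log-lower b {log-d} λ t∈ → ℚ.≤-trans (ι-mono-≤ 2^b≤l) (ℚ.<⇒≤ (log-d-lower t∈))

  loglog-d-upper : ∀ {a} → L loglog-d a → a ℚ.< ι (suc b)
  loglog-d-upper = log-upper (suc b) {log-d} λ t∈ →
    ℚ.≤-trans (ℚ.<⇒≤ (log-d-upper t∈)) (ι-mono-≤ l<2^b+1)

  log-r-lower : ∀ {e} → U logr e → ι k ℚ.< e
  log-r-lower = log-lower k {fromℕ r} λ r<t → ℚ.≤-trans (ι-mono-≤ 2^k≤r) (ℚ.<⇒≤ (fromℕ-U r<t))

  log-d≥0 : ∀ {e} → U log-d e → 0ℚ ℚ.≤ e
  log-d≥0 e∈ = ℚ.≤-trans (0≤ι l) (ℚ.<⇒≤ (log-d-lower e∈))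

  -- Writing τ as x / y and clearing the denominator, once in the first alternative and twice in the
  -- second, leads back to natural numbers.
  rational-bound : ∀ τ → 0ℚ ℚ.< τ →
    τ ℚ.* (ι r ℚ.* ι b) ℚ.≤ ι (l + 1) ⊎ τ ℚ.* τ ℚ.* ι k ℚ.≤ ι (4 * (l + 1)) →
    ι n ℚ.* τ ℚ.≤ ι 512 ℚ.* (ι d ℚ.* ι (α G))
  rational-bound (mkℚ -[1+ _ ] _ _) 0<τ _ = contradiction (ℚ.<-trans 0<τ (ℚ.negative⁻¹ _)) (ℚ.<-irrefl refl)
  rational-bound τ@(mkℚ (ℤ.+ x) y-1 c) 0<τ H =
    ℚ.*-cancelʳ-≤-pos (ι y) {{ℚ.positive (0<ι {y} (s≤s z≤n))}} (begin
      ι n ℚ.* τ ℚ.* ι y                             ≡⟨ trans (ℚ.*-assoc (ι n) τ (ι y)) (cong (ι n ℚ.*_) clear) ⟩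
      ι n ℚ.* ι x                                   ≡⟨ ι-* n x ⟨
      ι (n * x)                                     ≤⟨ ι-mono-≤ (fractional-bound G {r} {d} {l} {b} {k} x y free deg 1≤r 4≤l 1≤b
                                                         2^l≤d l<2^b+1 1≤k (<⇒≤ r<2^k+1) (s≤s z≤n) (integral H)) ⟩
      ι (512 * (y * (d * α G)))                     ≡⟨ ι-*₄ 512 y d (α G) ⟩
      ι 512 ℚ.* (ι y ℚ.* (ι d ℚ.* ι (α G)))         ≡⟨ x∙y∙z≡xz∙y (ι 512) (ι y) (ι d ℚ.* ι (α G)) ⟩
      ι 512 ℚ.* (ι d ℚ.* ι (α G)) ℚ.* ι y           ∎)
    where
    open ℚ.≤-Reasoning
    y = suc y-1
    clear : τ ℚ.* ι y ≡ ι x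
    clear = ↧-clear x y-1 c
    ι-*₃ : ∀ u v w → ι (u * (v * w)) ≡ ι u ℚ.* (ι v ℚ.* ι w)
    ι-*₃ u v w = trans (ι-* u (v * w)) (cong (ι u ℚ.*_) (ι-* v w))
    ι-*₄ : ∀ u v w z → ι (u * (v * (w * z))) ≡ ι u ℚ.* (ι v ℚ.* (ι w ℚ.* ι z))
    ι-*₄ u v w z = trans (ι-* u (v * (w * z))) (cong (ι u ℚ.*_) (ι-*₃ v w z))
    integral : τ ℚ.* (ι r ℚ.* ι b) ℚ.≤ ι (l + 1) ⊎ τ ℚ.* τ ℚ.* ι k ℚ.≤ ι (4 * (l + 1)) →
      x * (r * b) ≤ y * (l + 1) ⊎ x * x * k ≤ 4 * (y * y * (l + 1))
    integral (inj₁ H₁) = inj₁ (ι-cancel-≤ (begin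
      ι (x * (r * b))                       ≡⟨ trans (ι-*₃ x r b) (cong (ℚ._* (ι r ℚ.* ι b)) (sym clear)) ⟩
      τ ℚ.* ι y ℚ.* (ι r ℚ.* ι b)           ≡⟨ xy∙z≡y∙xz τ (ι y) (ι r ℚ.* ι b) ⟩
      ι y ℚ.* (τ ℚ.* (ι r ℚ.* ι b))         ≤⟨ *-monoʳ (0≤ι y) H₁ ⟩
      ι y ℚ.* ι (l + 1)                     ≡⟨ ι-* y (l + 1) ⟨
      ι (y * (l + 1))                       ∎))
    integral (inj₂ H₂) = inj₂ (ι-cancel-≤ (begin
      ι (x * x * k)                         ≡⟨ cong ι (*-assoc x x k) ⟩
      ι (x * (x * k))                       ≡⟨ ι-*₃ x x k ⟩
      ι x ℚ.* (ι x ℚ.* ι k)                 ≡⟨ cong (λ z → z ℚ.* (z ℚ.* ι k)) clear ⟨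
      τ ℚ.* ι y ℚ.* (τ ℚ.* ι y ℚ.* ι k)     ≡⟨ xy∙xyz≡y∙y∙xxz τ (ι y) (ι k) ⟩
      ι y ℚ.* (ι y ℚ.* (τ ℚ.* τ ℚ.* ι k))   ≤⟨ *-monoʳ (0≤ι y) (*-monoʳ (0≤ι y) H₂) ⟩
      ι y ℚ.* (ι y ℚ.* ι (4 * (l + 1)))     ≡⟨ ι-*₃ y y (4 * (l + 1)) ⟨
      ι (y * (y * (4 * (l + 1))))           ≡⟨ cong ι (e y (l + 1)) ⟩
      ι (4 * (y * y * (l + 1)))             ∎))
      where
      e : ∀ y z → y * (y * (4 * z)) ≡ 4 * (y * y * z)
      e y z = trans (sym (*-assoc y y (4 * z)))
        (trans (sym (*-assoc (y * y) 4 z)) (trans (cong (_* z) (*-comm (y * y) 4)) (*-assoc 4 (y * y) z)))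

  suc-l : ι (suc l) ≡ ι (l + 1)
  suc-l = cong ι (+-comm 1 l)

  log-quotient : ∀ {τ y Y} → 0ℚ ℚ.≤ τ → 0ℚ ℚ.≤ Y → (∀ {t} → U y t → Y ℚ.< t) →
    L (log-d /ᵣ y) τ → τ ℚ.* Y ℚ.≤ ι (l + 1)
  log-quotient {τ} {y} {Y} 0≤τ 0≤Y Y< τ∈
    with /ᵣ-L {log-d} {y} log-d≥0 (λ t∈ → ℚ.≤-<-trans 0≤Y (Y< t∈)) 0≤τ τ∈
  ... | a , t , a∈ , t∈ , τt<a = begin
    τ ℚ.* Y       ≤⟨ *-monoʳ 0≤τ (ℚ.<⇒≤ (Y< t∈)) ⟩
    τ ℚ.* t       ≤⟨ ℚ.<⇒≤ (ℚ.<-trans τt<a (log-d-upper a∈)) ⟩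
    ι (suc l)     ≡⟨ suc-l ⟩
    ι (l + 1)     ∎
    where open ℚ.≤-Reasoning

  √-quotient : ∀ {τ y Y} → 0ℚ ℚ.< τ → 0ℚ ℚ.≤ Y → (∀ {t} → U y t → Y ℚ.< t) →
    L (√ (log-d /ᵣ y)) τ → τ ℚ.* τ ℚ.* Y ℚ.≤ ι (l + 1)
  √-quotient 0<τ _ _ (inj₁ τ<0) = contradiction (ℚ.<-trans 0<τ τ<0) (ℚ.<-irrefl refl)
  √-quotient {y = y} 0<τ 0≤Y Y< (inj₂ ττ∈) =
    log-quotient {y = y} (*-nonneg (ℚ.<⇒≤ 0<τ) (ℚ.<⇒≤ 0<τ)) 0≤Y Y< ττ∈

  max-bound : ∀ τ → 0ℚ ℚ.< τ →
    L (log-d /ᵣ (fromℕ r *ᵣ loglog-d) ⊔ᵣ √ (log-d /ᵣ logr)) τ →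
    ι n ℚ.* τ ℚ.≤ ι 512 ℚ.* (ι d ℚ.* ι (α G))
  max-bound τ 0<τ (inj₁ τ∈) = rational-bound τ 0<τ (inj₁
    (log-quotient {y = fromℕ r *ᵣ loglog-d} (ℚ.<⇒≤ 0<τ) (*-nonneg (0≤ι r) (0≤ι b))
      (*ᵣ-U {fromℕ r} {loglog-d} (0≤ι r) (0≤ι b) (λ r<e → ℚ.<⇒≤ (fromℕ-U r<e)) (λ e∈ → ℚ.<⇒≤ (loglog-d-lower e∈))) τ∈))
  max-bound τ 0<τ (inj₂ τ∈) = rational-bound τ 0<τ (inj₂
    (ℚ.≤-trans (√-quotient {y = logr} 0<τ (0≤ι k) log-r-lower τ∈) (ι-mono-≤ (m≤n*m (l + 1) 4))))

  -- The case of r equal to a power of log d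

  module Power {c : Cut} (real : IsReal c) (1≤c : 1ᵣ ≤ᵣ c)
    (r≈ : fromℕ r ≈ᵣ log-d ^ᵣ c) where
    open IsReal real

    ordered : ∀ {a e} → L c a → U c e → a ℚ.≤ e
    ordered {a} {e} a∈ e∈ with a ℚ.≤? e
    ... | yes a≤e = a≤e
    ... | no a≰e = contradiction e∈ (disjoint (L-closed (ℚ.≰⇒> a≰e) a∈))

    c≥1 : ∀ {e} → U c e → 1ℚ ℚ.≤ e
    c≥1 {e} e∈ with 1ℚ ℚ.≤? e
    ... | yes 1≤e = 1≤e
    ... | no 1≰e = contradiction e∈ (disjoint (1≤c e (ℚ.≰⇒> 1≰e)))

    c≥0 : ∀ {e} → U c e → 0ℚ ℚ.≤ e
    c≥0 e∈ = ℚ.≤-trans (ℚ.<⇒≤ 0<1) (c≥1 e∈)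

    product-lower : ∀ {a t} → 0ℚ ℚ.≤ a → (∀ {e} → U c e → a ℚ.≤ e) →
      U (c *ᵣ loglog-d) t → a ℚ.* ι b ℚ.< t
    product-lower 0≤a a≤ = *ᵣ-U {c} {loglog-d} 0≤a (0≤ι b) a≤ (λ e∈ → ℚ.<⇒≤ (loglog-d-lower e∈))

    -- This keeps the denominator under the root positive and settles k = 1 in `k≤4t`.
    1<product : ∀ {t} → U (c *ᵣ loglog-d) t → 1ℚ ℚ.< t
    1<product t∈ = ℚ.≤-<-trans (ℚ.≤-trans (ℚ.≤-reflexive (sym (ι-/1 1))) (ι-mono-≤ 1≤b))
      (subst (ℚ._< _) (ℚ.*-identityˡ (ι b)) (product-lower (ℚ.<⇒≤ 0<1) c≥1 t∈))

    -- The estimates at hand place log log d only between b and b + 1 ≤ 2b, so comparing a lower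
    -- with an upper approximation of the product costs a factor 2.
    product-order : ∀ {s t} → 0ℚ ℚ.≤ s → L (c *ᵣ loglog-d) s → U (c *ᵣ loglog-d) t → s ℚ.< ι 2 ℚ.* t
    product-order {s} {t} 0≤s s∈ t∈
      with *ᵣ-L {c} {loglog-d} c≥0 (λ e∈ → ℚ.≤-trans (0≤ι b) (ℚ.<⇒≤ (loglog-d-lower e∈))) 0≤s s∈
    ... | a , e , a∈ , e∈ , 0<a , 0<e , s<ae = begin-strict
      s                           <⟨ s<ae ⟩
      a ℚ.* e                     ≤⟨ *-monoʳ (ℚ.<⇒≤ 0<a) (ℚ.<⇒≤ (loglog-d-upper e∈)) ⟩
      a ℚ.* ι (suc b)             ≤⟨ *-monoʳ (ℚ.<⇒≤ 0<a) (ι-mono-≤ (≤-trans (+-monoˡ-≤ b 1≤b) (≤-reflexive (cong (b +_) (sym (+-identityʳ b)))))) ⟩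
      a ℚ.* ι (2 * b)             ≡⟨ cong (a ℚ.*_) (ι-* 2 b) ⟩
      a ℚ.* (ι 2 ℚ.* ι b)         ≡⟨ x∙yz≡y∙xz a (ι 2) (ι b) ⟩
      ι 2 ℚ.* (a ℚ.* ι b)         <⟨ ℚ.*-monoʳ-<-pos (ι 2) {{ℚ.positive (0<ι {2} (s≤s z≤n))}} (product-lower (ℚ.<⇒≤ 0<a) (ordered a∈) t∈) ⟩
      ι 2 ℚ.* t                   ∎
      where
      open ℚ.≤-Reasoning

    -- Only 2^(k - 1) < r is strict, so 2^(k - 1) is the rational at which the cut of r is evaluated.
    k≤4t : ∀ {t} → U (c *ᵣ loglog-d) t → ι k ℚ.≤ ι 4 ℚ.* t
    k≤4t {t} t∈ = bound k 1≤k 2^k≤r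
      where
      open ℚ.≤-Reasoning
      0≤t : 0ℚ ℚ.≤ t
      0≤t = ℚ.≤-trans (ℚ.<⇒≤ 0<1) (ℚ.<⇒≤ (1<product t∈))
      2·2t≡4t : ι 2 ℚ.* (ι 2 ℚ.* t) ≡ ι 4 ℚ.* t
      2·2t≡4t = trans (sym (ℚ.*-assoc (ι 2) (ι 2) t)) (cong (ℚ._* t) (sym (ι-* 2 2)))
      bound : ∀ k → 1 ≤ k → 2 ^ k ≤ r → ι k ℚ.≤ ι 4 ℚ.* t
      -- Here k ≤ 2 (k - 1) fails, and the bound rests on t > 1 instead.
      bound (suc 0) _ _ = begin
        ι 1               ≡⟨ ι-/1 1 ⟩
        1ℚ                ≤⟨ ℚ.<⇒≤ (1<product t∈) ⟩
        t                 ≡⟨ ℚ.*-identityˡ t ⟨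
        1ℚ ℚ.* t          ≡⟨ cong (ℚ._* t) (ι-/1 1) ⟨
        ι 1 ℚ.* t         ≤⟨ *-monoˡ 0≤t (ι-mono-≤ {1} {4} (s≤s z≤n)) ⟩
        ι 4 ℚ.* t         ∎
      bound (suc j@(suc i)) _ 2^k≤r
        with proj₁ r≈ (ι (2 ^ j)) (fromℕ-L⁺ {r} (ι-mono-< (<-≤-trans (^-monoʳ-< 2 (s≤s (s≤s z≤n)) (n<1+n j)) 2^k≤r)))
      ... | s , s∈ , 2^j<2^s = begin
        -- For k at least 2, k is at most 2 (k - 1). This 2 and the one from `product-order` make up
        -- the 4.
        ι (suc j)               ≤⟨ ι-mono-≤ (s≤s (≤-trans (m≤n+m j i) (≤-reflexive (cong (i +_) (sym (+-identityʳ j)))))) ⟩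
        ι (2 * j)               ≡⟨ ι-* 2 j ⟩
        ι 2 ℚ.* ι j             ≤⟨ *-monoʳ (0≤ι 2) (ℚ.<⇒≤ (ℚ.<-trans j<s (product-order (ℚ.≤-trans (0≤ι j) (ℚ.<⇒≤ j<s)) s∈ t∈))) ⟩
        ι 2 ℚ.* (ι 2 ℚ.* t)     ≡⟨ 2·2t≡4t ⟩
        ι 4 ℚ.* t               ∎
        where
        j<s : ι j ℚ.< s
        j<s = <2^-lower j ℚ.≤-refl 2^j<2^s

    -- Up to the factor 4 the denominator c · log log d dominates log r, so the second alternative
    -- of `rational-bound` applies, where that factor is allowed for.
    power-bound : ∀ τ → 0ℚ ℚ.< τ → L (√ (log-d /ᵣ (c *ᵣ loglog-d))) τ →
      ι n ℚ.* τ ℚ.≤ ι 512 ℚ.* (ι d ℚ.* ι (α G))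
    power-bound τ 0<τ (inj₁ τ<0) = contradiction (ℚ.<-trans 0<τ τ<0) (ℚ.<-irrefl refl)
    power-bound τ 0<τ (inj₂ ττ∈) with /ᵣ-L {log-d} {c *ᵣ loglog-d} log-d≥0
      (λ t∈ → ℚ.<-trans 0<1 (1<product t∈)) (*-nonneg (ℚ.<⇒≤ 0<τ) (ℚ.<⇒≤ 0<τ)) ττ∈
    ... | a , t , a∈ , t∈ , ττt<a = rational-bound τ 0<τ (inj₂ (begin
      τ ℚ.* τ ℚ.* ι k               ≤⟨ *-monoʳ (*-nonneg (ℚ.<⇒≤ 0<τ) (ℚ.<⇒≤ 0<τ)) (k≤4t t∈) ⟩
      τ ℚ.* τ ℚ.* (ι 4 ℚ.* t)       ≡⟨ x∙yz≡y∙xz (τ ℚ.* τ) (ι 4) t ⟩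
      ι 4 ℚ.* (τ ℚ.* τ ℚ.* t)       ≤⟨ *-monoʳ (0≤ι 4) (ℚ.<⇒≤ (ℚ.<-trans ττt<a (log-d-upper a∈))) ⟩
      ι 4 ℚ.* ι (suc l)             ≡⟨ cong (ι 4 ℚ.*_) suc-l ⟩
      ι 4 ℚ.* ι (l + 1)             ≡⟨ ι-* 4 (l + 1) ⟨
      ι (4 * (l + 1))               ∎))
      where
      open ℚ.≤-Reasoning

theorem2 : (Σ[ c ∈ Cut ] IsReal c × 0ᵣ <ᵣ c ×
    (∀ (r d : ℕ) → 2 ≤ r → 16 ≤ d →
    ∀ (n : ℕ) (G : Graph n) → MaxDegreeAtMost d G → CliqueFree r G →
    c *ᵣ (fromℕ n /ᵣ fromℕ d) *ᵣ
    ( log (fromℕ d) /ᵣ (fromℕ r *ᵣ log (log (fromℕ d)))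
    ⊔ᵣ √ (log (fromℕ d) /ᵣ log (fromℕ r)) )
    ≤ᵣ fromℕ (α G)))
    ×
    (Σ[ c ∈ Cut ] IsReal c × 0ᵣ <ᵣ c ×
    (∀ (r d : ℕ) → 2 ≤ r → 16 ≤ d →
    ∀ (c′ : Cut) → IsReal c′ → 1ᵣ ≤ᵣ c′ →
    fromℕ r ≈ᵣ log (fromℕ d) ^ᵣ c′ →
    ∀ (n : ℕ) (G : Graph n) → MaxDegreeAtMost d G → CliqueFree r G →
    c *ᵣ (fromℕ n /ᵣ fromℕ d) *ᵣ
    √ (log (fromℕ d) /ᵣ (c′ *ᵣ log (log (fromℕ d))))
    ≤ᵣ fromℕ (α G)))
theorem2 =
  (fromℚ c₀ , c₀-real , 0<c₀ , λ r d 2≤r 16≤d n G deg free →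
    -- An upper bound of the maximum is in particular one of the square root, whose upper cut
    -- contains positive rationals only.
    scaled-bound positive-c₀ (0<ι {512} (s≤s z≤n)) c₀*512 {α G} (≤-trans (s≤s z≤n) 16≤d) (λ (_ , 0<e , _) → ℚ.<⇒≤ 0<e)
      (Bounds.max-bound 2≤r 16≤d G deg free)) ,
  (fromℚ c₀ , c₀-real , 0<c₀ , λ r d 2≤r 16≤d c′ real 1≤c′ r≈ n G deg free →
    scaled-bound positive-c₀ (0<ι {512} (s≤s z≤n)) c₀*512 {α G} (≤-trans (s≤s z≤n) 16≤d) (λ (0<e , _) → ℚ.<⇒≤ 0<e)
      (Bounds.Power.power-bound 2≤r 16≤d G deg free real 1≤c′ r≈))
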